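{- $P\Sigma_1$ proves the totality of the Ackermann–Péter function, i.e. $P\Sigma_1\vdash\forall m\,\forall n\,\exists k\,\phi_A(m,n,k)$, where $\phi_A(m,n,k)$ is the natural $\Sigma_1$-formula defining the graph of the Ackermann–Péter function $A$.
   Context: The Ackermann–Péter function is given by $A(0,n)=n+1$, $A(m,0)=A(m-1,1)$ for $m>0$, and $A(m,n)=A(m-1,A(m,n-1))$ for $m,n>0$; $\phi_A(m,n,k)$ is the $\Sigma_1$-formula expressing (via existence of a coded finite computation) that $A(m,n)=k$. $I\Sigma_1$ is Peano arithmetic without induction plus induction for $\Sigma_1$-formulas. Finite sequences are coded by numbers; $\mathrm{lth}(s)$ is the length and $(s)_i$ the $i$-th entry. For a formula $\phi(x,y)$ (possibly with parameters), $\mathsf{PFUN}(\phi)$ states that for each $x$ there is at most one $y$ with $\phi(x,y)$; $\mathsf{Approx}_\phi(s)$ states that $s$ codes a finite sequence such that for all $i<\mathrm{lth}(s)-1$ and all $x,y$, if $x\le(s)_i$ and $\phi(x,y)$ then $y\le(s)_{i+1}$; $P\phi$ is $\mathsf{PFUN}(\phi)\to\forall z\,\exists s\,(\mathsf{Approx}_\phi(s)\wedge\mathrm{lth}(s)=z)$. $P\Sigma_1$ is $I\Sigma_1$ plus all $P\phi$ with $\phi\in\Sigma_1$. -}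

module Defs where

open import Data.Nat using (ℕ; zero; suc; _+_; _∸_)

infixl 7 _`*_
infixl 6 _`+_

data Term : Set where
  var  : ℕ → Term
  `0   : Term
  `1   : Term
  _`+_ : Term → Term → Term
  _`*_ : Term → Term → Term

infix  5 _≐_ _≺_
infixr 3 _⇒_

data Formula : Set where
  ⊥'   : Formula
  _≐_  : Term → Term → Formula
  _≺_  : Term → Term → Formula
  _⇒_  : Formula → Formula → Formula
  ∀'   : Formula → Formula   -- binds variable 0

renT : (ℕ → ℕ) → Term → Term
renT ρ (var x)  = var (ρ x)
renT ρ `0       = `0
renT ρ `1       = `1
renT ρ (t `+ u) = renT ρ t `+ renT ρ u
renT ρ (t `* u) = renT ρ t `* renT ρ u

Subst : Set
Subst = ℕ → Term

subT : Subst → Term → Term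
subT σ (var x)  = σ x
subT σ `0       = `0
subT σ `1       = `1
subT σ (t `+ u) = subT σ t `+ subT σ u
subT σ (t `* u) = subT σ t `* subT σ u

ext : Subst → Subst
ext σ zero    = var zero
ext σ (suc x) = renT suc (σ x)

sub : Subst → Formula → Formula
sub σ ⊥'      = ⊥'
sub σ (t ≐ u) = subT σ t ≐ subT σ u
sub σ (t ≺ u) = subT σ t ≺ subT σ u
sub σ (φ ⇒ ψ) = sub σ φ ⇒ sub σ ψ
sub σ (∀' φ)  = ∀' (sub (ext σ) φ)

↑ : Formula → Formula
↑ = sub (λ x → var (suc x))

σ₀ : Term → Subst
σ₀ t zero    = t
σ₀ t (suc x) = var x

_[_]₀ : Formula → Term → Formula
φ [ t ]₀ = sub (σ₀ t) φ

σ₀' : Term → Subst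
σ₀' t zero    = t
σ₀' t (suc x) = var (suc x)

infixr 4 _∧'_ _∨'_
infix  5 _≼_

¬' : Formula → Formula
¬' φ = φ ⇒ ⊥'

_∨'_ : Formula → Formula → Formula
φ ∨' ψ = ¬' φ ⇒ ψ

_∧'_ : Formula → Formula → Formula
φ ∧' ψ = ¬' (φ ⇒ ¬' ψ)

∃' : Formula → Formula
∃' φ = ¬' (∀' (¬' φ))

_≼_ : Term → Term → Formula
t ≼ u = (t ≺ u) ∨' (t ≐ u)

data Δ₀ : Formula → Set where
  ⊥-Δ₀   : Δ₀ ⊥'
  ≐-Δ₀   : ∀ t u → Δ₀ (t ≐ u)
  ≺-Δ₀   : ∀ t u → Δ₀ (t ≺ u)
  ⇒-Δ₀   : ∀ {φ ψ} → Δ₀ φ → Δ₀ ψ → Δ₀ (φ ⇒ ψ)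
  ∀<-Δ₀  : ∀ {φ} t → Δ₀ φ → Δ₀ (∀' ((var zero ≺ renT suc t) ⇒ φ))
  ∃<-Δ₀  : ∀ {φ} t → Δ₀ φ → Δ₀ (∃' ((var zero ≺ renT suc t) ∧' φ))

data Σ₁ : Formula → Set where
  Δ₀-Σ₁ : ∀ {φ} → Δ₀ φ → Σ₁ φ
  ∃-Σ₁  : ∀ {φ} → Σ₁ φ → Σ₁ (∃' φ)

-- A Hilbert-style calculus for classical first-order logic with
-- equality.  Axioms of a theory may be open formulas; they are read as
-- their universal closures (generalisation is unrestricted).

Theory : Set₁
Theory = Formula → Set

infix 2 _⊢_

data _⊢_ (T : Theory) : Formula → Set where
  ax     : ∀ {φ} → T φ → T ⊢ φ
  mp     : ∀ {φ ψ} → T ⊢ (φ ⇒ ψ) → T ⊢ φ → T ⊢ ψ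
  gen    : ∀ {φ} → T ⊢ φ → T ⊢ ∀' φ
  ax-K   : ∀ φ ψ → T ⊢ (φ ⇒ ψ ⇒ φ)
  ax-S   : ∀ φ ψ χ → T ⊢ ((φ ⇒ ψ ⇒ χ) ⇒ (φ ⇒ ψ) ⇒ φ ⇒ χ)
  ax-DN  : ∀ φ → T ⊢ (¬' (¬' φ) ⇒ φ)
  ax-∀E  : ∀ φ t → T ⊢ (∀' φ ⇒ φ [ t ]₀)
  ax-∀D  : ∀ φ ψ → T ⊢ (∀' (↑ φ ⇒ ψ) ⇒ φ ⇒ ∀' ψ)
  ax-refl : ∀ t → T ⊢ (t ≐ t)
  ax-eq  : ∀ φ s t → T ⊢ (s ≐ t ⇒ φ [ s ]₀ ⇒ φ [ t ]₀)

-- Building formulas with a "levels" interface, to avoid index errors.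
-- A builder is evaluated at the current binder depth d; the variable
-- bound at depth l is referenced at depth d as var (d ∸ suc l); the
-- outer free variable k is referenced as var (k + d).

TB : Set
TB = ℕ → Term

FB : Set
FB = ℕ → Formula

lvl : ℕ → TB
lvl l d = var (d ∸ suc l)

free : ℕ → TB
free k d = var (k + d)

infixl 7 _*B_
infixl 6 _+B_
infix  5 _≐B_ _≺B_ _≼B_
infixr 4 _∧B_ _∨B_
infixr 3 _⇒B_

0B 1B : TB
0B d = `0
1B d = `1

_+B_ _*B_ : TB → TB → TB
(t +B u) d = t d `+ u d
(t *B u) d = t d `* u d

_≐B_ _≺B_ _≼B_ : TB → TB → FB
(t ≐B u) d = t d ≐ u d
(t ≺B u) d = t d ≺ u d
(t ≼B u) d = t d ≼ u d

_⇒B_ _∧B_ _∨B_ : FB → FB → FB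
(φ ⇒B ψ) d = φ d ⇒ ψ d
(φ ∧B ψ) d = φ d ∧' ψ d
(φ ∨B ψ) d = φ d ∨' ψ d

¬B : FB → FB
¬B φ d = ¬' (φ d)

allB exB : (TB → FB) → FB
allB f d = ∀' (f (lvl d) (suc d))
exB  f d = ∃' (f (lvl d) (suc d))

all<B ex<B : TB → (TB → FB) → FB
all<B t f d = ∀' ((var zero ≺ renT suc (t d)) ⇒ f (lvl d) (suc d))
ex<B  t f d = ∃' ((var zero ≺ renT suc (t d)) ∧' f (lvl d) (suc d))

-- Plug terms into a formula φ(x,y) whose variable 0 is y, variable 1
-- is x, and variable k+2 is the k-th parameter (an outer free variable).
σxy : Term → Term → ℕ → Subst
σxy x y d zero          = y
σxy x y d (suc zero)    = x
σxy x y d (suc (suc k)) = var (k + d)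

plug2 : Formula → TB → TB → FB
plug2 φ x y d = sub (σxy (x d) (y d) d) φ

-- Coding of finite sequences (Δ₀-definable).
-- Cantor pairing:  ⟨a,b⟩ = c  iff  2c = (a+b)(a+b+1) + 2b.
-- Every number s is a pair ⟨l , ⟨a , b⟩⟩; it codes the sequence of
-- length lth(s) = l whose i-th entry is (s)_i = a mod (1 + (i+1)·b)
-- (Gödel's β-function).

PairB : TB → TB → TB → FB
PairB a b c = (c +B c) ≐B ((a +B b) *B (a +B b +B 1B) +B (b +B b))

LthB : TB → TB → FB
LthB s l = ex<B (s +B 1B) λ w → PairB l w s

EntB : TB → TB → TB → FB
EntB s i v =
  ex<B (s +B 1B) λ l → ex<B (s +B 1B) λ w →
  ex<B (s +B 1B) λ a → ex<B (s +B 1B) λ b → ex<B (s +B 1B) λ q →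
  let dv = 1B +B (i +B 1B) *B b in
  PairB l w s ∧B PairB a b w ∧B (v ≺B dv) ∧B (a ≐B (q *B dv +B v))

PFUN : Formula → Formula
PFUN φ = (allB λ x → allB λ y → allB λ y' →
           (plug2 φ x y ∧B plug2 φ x y') ⇒B (y ≐B y')) 0

ApproxB : Formula → TB → FB
ApproxB φ s =
  allB λ i → allB λ l → allB λ u → allB λ v →
    (LthB s l ∧B (i +B 1B ≺B l) ∧B EntB s i u ∧B EntB s (i +B 1B) v) ⇒B
    (allB λ x → allB λ y → (x ≼B u ∧B plug2 φ x y) ⇒B (y ≼B v))

P : Formula → Formula
P φ = PFUN φ ⇒ (allB λ z → exB λ s → ApproxB φ s ∧B LthB s z) 0

-- Axioms of PA⁻ (Kaye, Models of Peano Arithmetic, §2.1)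
data PA⁻ : Formula → Set where
  +-assoc  : PA⁻ ((allB λ x → allB λ y → allB λ z → ((x +B y) +B z) ≐B (x +B (y +B z))) 0)
  +-comm   : PA⁻ ((allB λ x → allB λ y → (x +B y) ≐B (y +B x)) 0)
  *-assoc  : PA⁻ ((allB λ x → allB λ y → allB λ z → ((x *B y) *B z) ≐B (x *B (y *B z))) 0)
  *-comm   : PA⁻ ((allB λ x → allB λ y → (x *B y) ≐B (y *B x)) 0)
  distr    : PA⁻ ((allB λ x → allB λ y → allB λ z → (x *B (y +B z)) ≐B (x *B y +B x *B z)) 0)
  +-id-*-0 : PA⁻ ((allB λ x → ((x +B 0B) ≐B x) ∧B ((x *B 0B) ≐B 0B)) 0)
  *-id     : PA⁻ ((allB λ x → (x *B 1B) ≐B x) 0)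
  <-trans  : PA⁻ ((allB λ x → allB λ y → allB λ z → ((x ≺B y) ∧B (y ≺B z)) ⇒B (x ≺B z)) 0)
  <-irrefl : PA⁻ ((allB λ x → ¬B (x ≺B x)) 0)
  trichot  : PA⁻ ((allB λ x → allB λ y → (x ≺B y) ∨B (x ≐B y) ∨B (y ≺B x)) 0)
  <-+      : PA⁻ ((allB λ x → allB λ y → allB λ z → (x ≺B y) ⇒B ((x +B z) ≺B (y +B z))) 0)
  <-*      : PA⁻ ((allB λ x → allB λ y → allB λ z → ((0B ≺B z) ∧B (x ≺B y)) ⇒B ((x *B z) ≺B (y *B z))) 0)
  <-diff   : PA⁻ ((allB λ x → allB λ y → (x ≺B y) ⇒B (exB λ z → (x +B z) ≐B y)) 0)
  0<1-disc : PA⁻ (((0B ≺B 1B) ∧B (allB λ x → (0B ≺B x) ⇒B (1B ≼B x))) 0)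
  0-least  : PA⁻ ((allB λ x → 0B ≼B x) 0)

-- Induction axiom for φ (variable 0 = induction variable, others = parameters):
--   φ(0) → ∀x (φ(x) → φ(x+1)) → ∀x φ(x)
Ind : Formula → Formula
Ind φ = φ [ `0 ]₀ ⇒ ∀' (φ ⇒ sub (σ₀' (var zero `+ `1)) φ) ⇒ ∀' φ

data IΣ₁ : Formula → Set where
  base : ∀ {φ} → PA⁻ φ → IΣ₁ φ
  ind  : ∀ {φ} → Σ₁ φ → IΣ₁ (Ind φ)

-- PΣ₁ = IΣ₁ + { P φ : φ ∈ Σ₁ }   (φ(x,y): var 1 = x, var 0 = y, rest parameters)
data PΣ₁ : Formula → Set where
  iΣ₁ : ∀ {φ} → IΣ₁ φ → PΣ₁ φ
  pΣ₁ : ∀ {φ} → Σ₁ φ → PΣ₁ (P φ)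

-- The Σ₁-formula φ_A(m,n,k): there is a coded computation, i.e. a
-- sequence s of length l each of whose entries is a triple ⟨a,b,c⟩
-- (coded as ⟨a,⟨b,c⟩⟩) justified by the defining equations of A from
-- earlier entries, and some entry is ⟨m,n,k⟩.

TripB : TB → TB → TB → TB → FB
TripB a b c t = ex<B (t +B 1B) λ w → PairB b c w ∧B PairB a w t

GoodB : TB → TB → FB
GoodB s j =
  ex<B (s +B 1B) λ t → ex<B (s +B 1B) λ a → ex<B (s +B 1B) λ b → ex<B (s +B 1B) λ c →
    EntB s j t ∧B TripB a b c t ∧B
    ( -- A(0,b) = b+1
      ((a ≐B 0B) ∧B (c ≐B (b +B 1B)))
    ∨B -- A(a'+1,0) = A(a',1)
      ((0B ≺B a) ∧B (b ≐B 0B) ∧B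
        (ex<B j λ j' → ex<B (s +B 1B) λ t' → ex<B (s +B 1B) λ a' →
           EntB s j' t' ∧B ((a' +B 1B) ≐B a) ∧B TripB a' 1B c t'))
    ∨B -- A(a'+1,b'+1) = A(a', A(a'+1,b'))
      ((0B ≺B a) ∧B (0B ≺B b) ∧B
        (ex<B j λ j₁ → ex<B j λ j₂ →
         ex<B (s +B 1B) λ t₁ → ex<B (s +B 1B) λ t₂ →
         ex<B (s +B 1B) λ a' → ex<B (s +B 1B) λ b' → ex<B (s +B 1B) λ r →
           EntB s j₁ t₁ ∧B EntB s j₂ t₂ ∧B ((a' +B 1B) ≐B a) ∧B ((b' +B 1B) ≐B b) ∧B
           TripB a b' r t₁ ∧B TripB a' r c t₂)))

φA-B : TB → TB → TB → FB
φA-B m n k =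
  exB λ s → exB λ l →
    LthB s l ∧B (all<B l λ j → GoodB s j) ∧B
    (ex<B l λ j → ex<B (s +B 1B) λ t → EntB s j t ∧B TripB m n k t)

AckTotal : Formula
AckTotal = (allB λ m → allB λ n → exB λ k → φA-B m n k) 0

{-# OPTIONS --safe #-}

-- By a constructive form of Gödel's completeness theorem it suffices to
-- verify totality in models of PΣ₁ in which falsity may be any type.
-- There, fix m and n₀.  For x = n(m+1) + α with α ≤ m let φ(x) be the least
-- y that bounds (n₀+1)(m+1), a coded computation of A(α,0),…,A(α,n-1), and
-- (r+1)(m+1), where r is the argument to which the equation for A(α,n)
-- applies A(α-1,·).  Being a minimum, φ is trivially a partial function, so
-- P φ yields s of length m+2 that dominates φ step by step.  Let N_i be the
-- quotient of (s)_i by m+1.  By Σ₁-induction on a, some computation contains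
-- A(a,n) for all n < N_i with i = m+1-a: if r is the argument belonging to
-- (a+1,n) with n < N_i, then (r+1)(m+1) ≤ (s)_{i+1}, so r < N_{i+1} and
-- A(a,r) is available.  Since n₀ < N_1, this gives A(m,n₀).  Computations
-- are merged by formalising Gödel's β-lemma.

module Submission where

open import Defs
  hiding (+-assoc; +-comm; *-assoc; *-comm; <-trans)
import Defs
open import Algebra.Bundles using (CommutativeSemiring)
open import Algebra.Structures.Biased using (isCommutativeSemiringˡ)
open import Data.Bool.Base using (Bool; true; false; _∧_; T)
open import Data.Bool.Properties using (T-∧)
open import Data.Empty using (⊥; ⊥-elim)
open import Data.List.Base using (List; []; _∷_; length)
open import Data.Nat.Base using (ℕ; zero; suc; pred; z≤n; s≤s)
import Data.Nat.Base as ℕ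
import Data.Nat.Properties as ℕ
open import Data.Product.Base using (Σ; ∃; _×_; _,_; proj₁; proj₂)
open import Data.Sum.Base using (_⊎_; inj₁; inj₂; [_,_]′)
open import Function.Base using (_∘_; id)
open import Function.Bundles using (Equivalence)
open import Level using (Level; 0ℓ) renaming (suc to lsuc)
open import Relation.Binary.PropositionalEquality as ≡ using (_≡_)
open import Relation.Binary.Structures using (IsEquivalence)
open import Relation.Nullary using (yes; no)

-- Substitution

-- Proving totality of A(m,·) by induction on m would be induction on a Π₂ statement, out of reach
-- of Σ₁-induction. The sequence s supplies in advance a bound N_i for the arguments occurring at
-- each level, so that the claim about a level only asks for one computation, which is Σ₁. The
-- schema `P` accepts partial functions, so φ can be used before its values are known to exist. All
-- data of a bound are themselves bounded by x, y or m: being a bound is then Δ₀, and so is being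
-- the least one. The factor m+1 lets one sequence serve all levels, since n < N and α ≤ m give
-- n(m+1) + α < N(m+1). Levels run against the indices of s because level a+1 calls level a at
-- arguments that only the next entry of s bounds. Nothing can be prescribed about (s)_0; this is
-- why (n₀+1)(m+1) is built into φ, so that already φ(0) ≤ (s)_1 forces n₀ < N_1.

fvT : Term → ℕ
fvT (var x)  = suc x
fvT `0       = 0
fvT `1       = 0
fvT (t `+ u) = fvT t ℕ.⊔ fvT u
fvT (t `* u) = fvT t ℕ.⊔ fvT u

-- A strict bound on the free variables in place of their set: freshness conditions become
-- inequalities, and the bound itself is a fresh variable.
fv : Formula → ℕ
fv ⊥'      = 0
fv (t ≐ u) = fvT t ℕ.⊔ fvT u
fv (t ≺ u) = fvT t ℕ.⊔ fvT u
fv (φ ⇒ ψ) = fv φ ℕ.⊔ fv ψ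
fv (∀' φ)  = pred (fv φ)

subT-agree : ∀ {σ τ} t → (∀ x → x ℕ.< fvT t → σ x ≡ τ x) → subT σ t ≡ subT τ t
subT-agree (var x)  h = h x ℕ.≤-refl
subT-agree `0       h = ≡.refl
subT-agree `1       h = ≡.refl
subT-agree (t `+ u) h = ≡.cong₂ _`+_ (subT-agree t λ x p → h x (ℕ.≤-trans p (ℕ.m≤m⊔n _ _)))
                                     (subT-agree u λ x p → h x (ℕ.≤-trans p (ℕ.m≤n⊔m (fvT t) _)))
subT-agree (t `* u) h = ≡.cong₂ _`*_ (subT-agree t λ x p → h x (ℕ.≤-trans p (ℕ.m≤m⊔n _ _)))
                                     (subT-agree u λ x p → h x (ℕ.≤-trans p (ℕ.m≤n⊔m (fvT t) _)))

<pred : ∀ {x n} → suc x ℕ.< n → x ℕ.< pred n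
<pred (s≤s p) = p

sub-agree : ∀ {σ τ} φ → (∀ x → x ℕ.< fv φ → σ x ≡ τ x) → sub σ φ ≡ sub τ φ
sub-agree ⊥'      h = ≡.refl
sub-agree (t ≐ u) h = ≡.cong₂ _≐_ (subT-agree t λ x p → h x (ℕ.≤-trans p (ℕ.m≤m⊔n _ _)))
                                  (subT-agree u λ x p → h x (ℕ.≤-trans p (ℕ.m≤n⊔m (fvT t) _)))
sub-agree (t ≺ u) h = ≡.cong₂ _≺_ (subT-agree t λ x p → h x (ℕ.≤-trans p (ℕ.m≤m⊔n _ _)))
                                  (subT-agree u λ x p → h x (ℕ.≤-trans p (ℕ.m≤n⊔m (fvT t) _)))
sub-agree (φ ⇒ ψ) h = ≡.cong₂ _⇒_ (sub-agree φ λ x p → h x (ℕ.≤-trans p (ℕ.m≤m⊔n _ _)))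
                                  (sub-agree ψ λ x p → h x (ℕ.≤-trans p (ℕ.m≤n⊔m (fv φ) _)))
sub-agree {σ} {τ} (∀' φ) h = ≡.cong ∀' (sub-agree φ agree)
  where
  agree : ∀ x → x ℕ.< fv φ → ext σ x ≡ ext τ x
  agree zero    p = ≡.refl
  agree (suc x) p = ≡.cong (renT suc) (h x (<pred p))

sub-cong : ∀ {σ τ} φ → (∀ x → σ x ≡ τ x) → sub σ φ ≡ sub τ φ
sub-cong φ h = sub-agree φ λ x _ → h x

subT-renT : ∀ σ ρ t → subT σ (renT ρ t) ≡ subT (σ ∘ ρ) t
subT-renT σ ρ (var x)  = ≡.refl
subT-renT σ ρ `0       = ≡.refl
subT-renT σ ρ `1       = ≡.refl
subT-renT σ ρ (t `+ u) = ≡.cong₂ _`+_ (subT-renT σ ρ t) (subT-renT σ ρ u)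
subT-renT σ ρ (t `* u) = ≡.cong₂ _`*_ (subT-renT σ ρ t) (subT-renT σ ρ u)

renT-subT : ∀ ρ σ t → renT ρ (subT σ t) ≡ subT (renT ρ ∘ σ) t
renT-subT ρ σ (var x)  = ≡.refl
renT-subT ρ σ `0       = ≡.refl
renT-subT ρ σ `1       = ≡.refl
renT-subT ρ σ (t `+ u) = ≡.cong₂ _`+_ (renT-subT ρ σ t) (renT-subT ρ σ u)
renT-subT ρ σ (t `* u) = ≡.cong₂ _`*_ (renT-subT ρ σ t) (renT-subT ρ σ u)

subT-subT : ∀ τ σ t → subT τ (subT σ t) ≡ subT (subT τ ∘ σ) t
subT-subT τ σ (var x)  = ≡.refl
subT-subT τ σ `0       = ≡.refl
subT-subT τ σ `1       = ≡.refl
subT-subT τ σ (t `+ u) = ≡.cong₂ _`+_ (subT-subT τ σ t) (subT-subT τ σ u)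
subT-subT τ σ (t `* u) = ≡.cong₂ _`*_ (subT-subT τ σ t) (subT-subT τ σ u)

subT-var : ∀ t → subT var t ≡ t
subT-var (var x)  = ≡.refl
subT-var `0       = ≡.refl
subT-var `1       = ≡.refl
subT-var (t `+ u) = ≡.cong₂ _`+_ (subT-var t) (subT-var u)
subT-var (t `* u) = ≡.cong₂ _`*_ (subT-var t) (subT-var u)

sub-var : ∀ φ → sub var φ ≡ φ
sub-var ⊥'      = ≡.refl
sub-var (t ≐ u) = ≡.cong₂ _≐_ (subT-var t) (subT-var u)
sub-var (t ≺ u) = ≡.cong₂ _≺_ (subT-var t) (subT-var u)
sub-var (φ ⇒ ψ) = ≡.cong₂ _⇒_ (sub-var φ) (sub-var ψ)
sub-var (∀' φ)  = ≡.cong ∀' (≡.trans (sub-cong φ ext-var) (sub-var φ))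
  where
  ext-var : ∀ x → ext var x ≡ var x
  ext-var zero    = ≡.refl
  ext-var (suc x) = ≡.refl

sub-sub : ∀ τ σ φ → sub τ (sub σ φ) ≡ sub (subT τ ∘ σ) φ
sub-sub τ σ ⊥'      = ≡.refl
sub-sub τ σ (t ≐ u) = ≡.cong₂ _≐_ (subT-subT τ σ t) (subT-subT τ σ u)
sub-sub τ σ (t ≺ u) = ≡.cong₂ _≺_ (subT-subT τ σ t) (subT-subT τ σ u)
sub-sub τ σ (φ ⇒ ψ) = ≡.cong₂ _⇒_ (sub-sub τ σ φ) (sub-sub τ σ ψ)
sub-sub τ σ (∀' φ)  = ≡.cong ∀' (≡.trans (sub-sub (ext τ) (ext σ) φ) (sub-cong φ ext-ext))
  where
  ext-ext : ∀ x → subT (ext τ) (ext σ x) ≡ ext (subT τ ∘ σ) x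
  ext-ext zero    = ≡.refl
  ext-ext (suc x) = ≡.trans (subT-renT (ext τ) suc (σ x)) (≡.sym (renT-subT suc τ (σ x)))

subT-σ₀-suc : ∀ t u → subT (σ₀ t) (renT suc u) ≡ u
subT-σ₀-suc t u = ≡.trans (subT-renT (σ₀ t) suc u) (subT-var u)

infixr 5 _◂_
_◂_ : ∀ {A : Set} → A → (ℕ → A) → ℕ → A
(d ◂ ρ) zero    = d
(d ◂ ρ) (suc x) = ρ x

sub-ext-σ₀ : ∀ σ t φ → sub (ext σ) φ [ t ]₀ ≡ sub (t ◂ σ) φ
sub-ext-σ₀ σ t φ = ≡.trans (sub-sub (σ₀ t) (ext σ) φ) (sub-cong φ pointwise)
  where
  pointwise : ∀ x → subT (σ₀ t) (ext σ x) ≡ (t ◂ σ) x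
  pointwise zero    = ≡.refl
  pointwise (suc x) = subT-σ₀-suc t (σ x)

-- An enumeration of all formulas

unpair : ℕ → ℕ × ℕ
unpair zero    = 0 , 0
unpair (suc n) with unpair n
... | zero  , y = suc y , 0
... | suc x , y = x , suc y

-- Recursion backwards along Cantor's antidiagonals, lexicographic in the sum s and in y: from (x,
-- y+1) to (x+1, y), and from (x+1, 0) to (0, x).
unpair-surjective : ∀ x y → ∃ λ n → unpair n ≡ (x , y)
unpair-surjective x y = diagonal (x ℕ.+ y) x y ≡.refl
  where

  next : ∀ {n x y} → unpair n ≡ (suc x , y) → unpair (suc n) ≡ (x , suc y)
  next {n} e with unpair n
  next ≡.refl | _ = ≡.refl
  wrap : ∀ {n y} → unpair n ≡ (0 , y) → unpair (suc n) ≡ (suc y , 0)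
  wrap {n} e with unpair n
  wrap ≡.refl | _ = ≡.refl
  diagonal : ∀ s x y → x ℕ.+ y ≡ s → ∃ λ n → unpair n ≡ (x , y)
  diagonal s x (suc y) e =
    let n , p = diagonal s (suc x) y (≡.trans (≡.sym (ℕ.+-suc x y)) e) in suc n , next {n} p
  diagonal zero    zero    zero e = 0 , ≡.refl
  diagonal (suc s) (suc x) zero e with diagonal s zero x
          (≡.cong pred (≡.trans (≡.cong suc (≡.sym (ℕ.+-identityʳ x))) e))
  ... | n , p = suc n , wrap {n} p

decodeTuple : ℕ → ℕ → List ℕ
decodeTuple zero    c = []
decodeTuple (suc l) c = proj₁ (unpair c) ∷ decodeTuple l (proj₂ (unpair c))

decodeTuple-surjective : ∀ xs → ∃ λ c → decodeTuple (length xs) c ≡ xs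
decodeTuple-surjective []       = 0 , ≡.refl
decodeTuple-surjective (x ∷ xs) with decodeTuple-surjective xs
... | c , p with unpair-surjective x c
... | n , q = n , ≡.cong₂ _∷_ (≡.cong proj₁ q) (≡.trans (≡.cong (decodeTuple (length xs) ∘ proj₂) q) p)

-- Formulas are enumerated as programs, in reverse Polish notation, of a
-- machine with a stack of terms and a stack of formulas.
exec : List ℕ → List Term → List Formula → List Formula
exec [] ts fs = fs
exec (0 ∷ c) ts fs = exec c (`0 ∷ ts) fs
exec (1 ∷ c) ts fs = exec c (`1 ∷ ts) fs
exec (2 ∷ c) (u ∷ t ∷ ts) fs = exec c ((t `+ u) ∷ ts) fs
exec (3 ∷ c) (u ∷ t ∷ ts) fs = exec c ((t `* u) ∷ ts) fs
exec (4 ∷ c) ts fs = exec c ts (⊥' ∷ fs)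
exec (5 ∷ c) (u ∷ t ∷ ts) fs = exec c ts ((t ≐ u) ∷ fs)
exec (6 ∷ c) (u ∷ t ∷ ts) fs = exec c ts ((t ≺ u) ∷ fs)
exec (7 ∷ c) ts (ψ ∷ φ ∷ fs) = exec c ts ((φ ⇒ ψ) ∷ fs)
exec (8 ∷ c) ts (φ ∷ fs) = exec c ts (∀' φ ∷ fs)
exec (suc (suc (suc (suc (suc (suc (suc (suc (suc x)))))))) ∷ c) ts fs = exec c (var x ∷ ts) fs
exec _ ts fs = []

codeT : Term → List ℕ → List ℕ
codeT (var x)  c = suc (suc (suc (suc (suc (suc (suc (suc (suc x)))))))) ∷ c
codeT `0       c = 0 ∷ c
codeT `1       c = 1 ∷ c
codeT (t `+ u) c = codeT t (codeT u (2 ∷ c))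
codeT (t `* u) c = codeT t (codeT u (3 ∷ c))

code : Formula → List ℕ → List ℕ
code ⊥'      c = 4 ∷ c
code (t ≐ u) c = codeT t (codeT u (5 ∷ c))
code (t ≺ u) c = codeT t (codeT u (6 ∷ c))
code (φ ⇒ ψ) c = code φ (code ψ (7 ∷ c))
code (∀' φ)  c = code φ (8 ∷ c)

exec-codeT : ∀ t c ts fs → exec (codeT t c) ts fs ≡ exec c (t ∷ ts) fs
exec-codeT (var x)  c ts fs = ≡.refl
exec-codeT `0       c ts fs = ≡.refl
exec-codeT `1       c ts fs = ≡.refl
exec-codeT (t `+ u) c ts fs = ≡.trans (exec-codeT t _ ts fs) (exec-codeT u _ (t ∷ ts) fs)
exec-codeT (t `* u) c ts fs = ≡.trans (exec-codeT t _ ts fs) (exec-codeT u _ (t ∷ ts) fs)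

exec-code : ∀ φ c ts fs → exec (code φ c) ts fs ≡ exec c ts (φ ∷ fs)
exec-code ⊥'      c ts fs = ≡.refl
exec-code (t ≐ u) c ts fs = ≡.trans (exec-codeT t _ ts fs) (exec-codeT u _ (t ∷ ts) fs)
exec-code (t ≺ u) c ts fs = ≡.trans (exec-codeT t _ ts fs) (exec-codeT u _ (t ∷ ts) fs)
exec-code (φ ⇒ ψ) c ts fs = ≡.trans (exec-code φ _ ts fs) (exec-code ψ _ ts (φ ∷ fs))
exec-code (∀' φ)  c ts fs = exec-code φ _ ts fs

top : List Formula → Formula
top []      = ⊥'
top (φ ∷ _) = φ

-- A number holds a length and a tuple of that length. Programs that get stuck or leave no formula
-- stand for `⊥'`.
enum : ℕ → Formula
enum n = top (exec (decodeTuple (proj₁ (unpair n)) (proj₂ (unpair n))) [] [])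

enum-surjective : ∀ φ → ∃ λ n → enum n ≡ φ
enum-surjective φ with decodeTuple-surjective (code φ [])
... | c , p with unpair-surjective (length (code φ [])) c
... | n , q = n , ≡.trans (≡.cong (λ z → top (exec (decodeTuple (proj₁ z) (proj₂ z)) [] [])) q)
                        (≡.trans (≡.cong (λ z → top (exec z [] [])) p)
                               (≡.cong top (exec-code φ [] [] [])))

-- Completeness

-- Falsity is interpreted by an arbitrary type R, so that inconsistent
-- theories have models too; this is what makes completeness constructive.
record Structure : Set₁ where
  infix  4 _≈_ _<ᴹ_
  field
    D         : Set
    0ᴹ 1ᴹ     : D
    _+ᴹ_ _*ᴹ_ : D → D → D
    _≈_ _<ᴹ_  : D → D → Set
    R         : Set

  Env : Set
  Env = ℕ → D

  ⟦_⟧ᵀ : Term → Env → D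
  ⟦ var x ⟧ᵀ  ρ = ρ x
  ⟦ `0 ⟧ᵀ     ρ = 0ᴹ
  ⟦ `1 ⟧ᵀ     ρ = 1ᴹ
  ⟦ t `+ u ⟧ᵀ ρ = ⟦ t ⟧ᵀ ρ +ᴹ ⟦ u ⟧ᵀ ρ
  ⟦ t `* u ⟧ᵀ ρ = ⟦ t ⟧ᵀ ρ *ᴹ ⟦ u ⟧ᵀ ρ

  ⟦_⟧ : Formula → Env → Set
  ⟦ ⊥' ⟧    ρ = R
  ⟦ t ≐ u ⟧ ρ = ⟦ t ⟧ᵀ ρ ≈ ⟦ u ⟧ᵀ ρ
  ⟦ t ≺ u ⟧ ρ = ⟦ t ⟧ᵀ ρ <ᴹ ⟦ u ⟧ᵀ ρ
  ⟦ φ ⇒ ψ ⟧ ρ = ⟦ φ ⟧ ρ → ⟦ ψ ⟧ ρ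
  ⟦ ∀' φ ⟧  ρ = ∀ d → ⟦ φ ⟧ (d ◂ ρ)

record IsModel (T : Theory) (M : Structure) : Set₁ where
  open Structure M
  field
    ≈-stable  : ∀ {x y} → ((x ≈ y → R) → R) → x ≈ y
    <-stable  : ∀ {x y} → ((x <ᴹ y → R) → R) → x <ᴹ y
    ≈-refl    : ∀ {x} → x ≈ x
    ≈-replace : ∀ φ ρ {x y} → x ≈ y → ⟦ φ ⟧ (x ◂ ρ) → ⟦ φ ⟧ (y ◂ ρ)
    sound     : ∀ {φ} → T φ → ∀ ρ → ⟦ φ ⟧ ρ

module Completeness (T : Theory) where

  ⊢-id : ∀ {φ} → T ⊢ (φ ⇒ φ)
  ⊢-id {φ} = mp (mp (ax-S φ (φ ⇒ φ) φ) (ax-K φ (φ ⇒ φ))) (ax-K φ φ)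

  -- The calculus has no substitution rule, so variable 0 is generalised and then instantiated by
  -- `σ 0`. Generalising lowers the bound on the free variables, and the recursion ends at closed
  -- formulas, which no substitution changes.
  ⊢-sub-closing : ∀ n φ σ → fv φ ℕ.≤ n → T ⊢ φ → T ⊢ sub σ φ
  ⊢-sub-closing zero φ σ p d =
    ≡.subst (T ⊢_) (≡.trans (≡.sym (sub-var φ))
            (sub-agree φ λ x q → ⊥-elim (ℕ.<-irrefl ≡.refl (ℕ.≤-trans (ℕ.≤-trans (s≤s z≤n) q) p)))) d
  ⊢-sub-closing (suc n) φ σ p d =
    ≡.subst (T ⊢_) (≡.trans (sub-ext-σ₀ (σ ∘ suc) (σ 0) φ) (sub-cong φ η))
      (mp (ax-∀E _ (σ 0)) (⊢-sub-closing n (∀' φ) (σ ∘ suc) (ℕ.pred-mono-≤ p) (gen d)))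
    where
    η : ∀ x → (σ 0 ◂ σ ∘ suc) x ≡ σ x
    η zero    = ≡.refl
    η (suc x) = ≡.refl

  ⊢-sub : ∀ {φ} σ → T ⊢ φ → T ⊢ sub σ φ
  ⊢-sub {φ} σ = ⊢-sub-closing (fv φ) φ σ ℕ.≤-refl

  -- Generalisation is confined to theorems of `T`, so the deduction theorem holds without a side
  -- condition on variables.
  data Der (S : Formula → Set) : Formula → Set where
    thm : ∀ {φ} → T ⊢ φ → Der S φ
    hyp : ∀ {φ} → S φ → Der S φ
    mp  : ∀ {φ ψ} → Der S (φ ⇒ ψ) → Der S φ → Der S ψ

  infixl 4 _,,_
  _,,_ : (Formula → Set) → Formula → Formula → Set
  (S ,, χ) φ = S φ ⊎ φ ≡ χ

  bind : ∀ {S S' φ} → (∀ {ψ} → S ψ → Der S' ψ) → Der S φ → Der S' φ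
  bind f (thm d)  = thm d
  bind f (hyp h)  = f h
  bind f (mp d e) = mp (bind f d) (bind f e)

  weaken : ∀ {S S' φ} → (∀ {ψ} → S ψ → S' ψ) → Der S φ → Der S' φ
  weaken f = bind (hyp ∘ f)

  const⇒ : ∀ {S χ φ} → Der S φ → Der S (χ ⇒ φ)
  const⇒ = mp (thm (ax-K _ _))

  deduction : ∀ {S χ φ} → Der (S ,, χ) φ → Der S (χ ⇒ φ)
  deduction (thm d)         = const⇒ (thm d)
  deduction (hyp (inj₁ h))  = const⇒ (hyp h)
  deduction (hyp (inj₂ ≡.refl)) = thm ⊢-id
  deduction (mp d e)        = mp (mp (thm (ax-S _ _ _)) (deduction d)) (deduction e)

  ⊢-Der : ∀ {φ} → Der (λ _ → ⊥) φ → T ⊢ φ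
  ⊢-Der (thm d)  = d
  ⊢-Der (mp d e) = mp (⊢-Der d) (⊢-Der e)

  efq : ∀ {S φ} → Der S ⊥' → Der S φ
  efq d = mp (thm (ax-DN _)) (const⇒ d)

  raa : ∀ {S φ} → Der (S ,, ¬' φ) ⊥' → Der S φ
  raa d = mp (thm (ax-DN _)) (deduction d)

  ↑⇒∀ : ∀ {S χ} → Der S χ → Der S (∀' (↑ χ))
  ↑⇒∀ {χ = χ} = mp (mp (thm (ax-∀D χ (↑ χ))) (thm (gen ⊢-id)))

  ∀-mp : ∀ {S φ ψ} → Der S (∀' (φ ⇒ ψ)) → Der S (∀' φ) → Der S (∀' ψ)
  ∀-mp {S} {φ} {ψ} d e = mp (mp (thm (ax-∀D (∀' φ) ψ))
          (mp (mp (thm (ax-∀D (∀' (φ ⇒ ψ)) (↑ (∀' φ) ⇒ ψ))) (thm (gen step))) d)) e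
    where
    at0 : ∀ φ → T ⊢ (↑ (∀' φ) ⇒ φ)
    at0 φ = ≡.subst (λ z → T ⊢ (↑ (∀' φ) ⇒ z))
      (≡.trans (sub-ext-σ₀ (var ∘ suc) (var 0) φ)
              (≡.trans (sub-cong φ (λ { zero → ≡.refl ; (suc x) → ≡.refl })) (sub-var φ)))
      (ax-∀E _ (var 0))
    step : T ⊢ (↑ (∀' (φ ⇒ ψ)) ⇒ ↑ (∀' φ) ⇒ ψ)
    step = ⊢-Der (deduction (deduction
      (mp (mp (thm (at0 (φ ⇒ ψ))) (hyp (inj₁ (inj₂ ≡.refl)))) (mp (thm (at0 φ)) (hyp (inj₂ ≡.refl))))))

  -- τ k is the renaming that makes a variable k that is fresh for S the
  -- variable bound by gen.
  τ : ℕ → Subst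
  τ k x with x ℕ.≟ k
  ... | yes _ = var 0
  ... | no  _ = var (suc x)

  τ-eq : ∀ k → τ k k ≡ var 0
  τ-eq k with k ℕ.≟ k
  ... | yes _ = ≡.refl
  ... | no ¬p = ⊥-elim (¬p ≡.refl)

  τ-lt : ∀ {k x} → x ℕ.< k → τ k x ≡ var (suc x)
  τ-lt {k} {x} p with x ℕ.≟ k
  ... | yes ≡.refl = ⊥-elim (ℕ.<-irrefl ≡.refl p)
  ... | no _     = ≡.refl

  -- `Der` cannot generalise, so the quantifier is introduced at the leaves: theorems are renamed
  -- and generalised in the calculus, hypotheses do not contain k and receive a vacuous quantifier.
  -- Then `∀-mp` recombines them.
  generalise : ∀ {S φ} k → (∀ {χ} → S χ → fv χ ℕ.≤ k) → Der S φ → Der S (∀' (sub (τ k) φ))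
  generalise k fresh (thm d)  = thm (gen (⊢-sub (τ k) d))
  generalise k fresh (hyp {χ} h)  =
    ≡.subst (λ z → Der _ (∀' z)) (sub-agree χ λ x p → ≡.sym (τ-lt (ℕ.≤-trans p (fresh h)))) (↑⇒∀ (hyp h))
  generalise k fresh (mp d e) = ∀-mp (generalise k fresh d) (generalise k fresh e)

  ∀-intro : ∀ {S ψ} k → (∀ {χ} → S χ → fv χ ℕ.≤ k) → fv ψ ℕ.≤ k → Der S (ψ [ var k ]₀) → Der S (∀' ψ)
  ∀-intro {S} {ψ} k fresh p d =
    ≡.subst (λ z → Der S (∀' z))
      (≡.trans (sub-sub (τ k) (σ₀ (var k)) ψ) (≡.trans (sub-agree ψ pointwise) (sub-var ψ)))
      (generalise k fresh d)
    where
    pointwise : ∀ x → x ℕ.< fv ψ → subT (τ k) (σ₀ (var k) x) ≡ var x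
    pointwise zero    q = τ-eq k
    pointwise (suc x) q = τ-lt (ℕ.≤-trans (ℕ.≤-trans (ℕ.n≤1+n _) q) p)

  -- The Henkin construction

  module Lindenbaum (goal : Formula) where

    R : Set
    R = T ⊢ goal

    -- The Henkin axiom for a universal quantifier: k names a counterexample if there is one. A
    -- fresh variable serves as the constant, so the language stays the same.
    henkin : ℕ → ℕ → Formula
    henkin k n = enum n [ var k ]₀ ⇒ ∀' (enum n)

    stageFv : ℕ → ℕ
    witness : ℕ → ℕ
    witness n = stageFv n ℕ.⊔ fv (enum n)
    stageFv zero    = fv (¬' goal)
    stageFv (suc n) = stageFv n ℕ.⊔ (fv (henkin (witness n) n) ℕ.⊔ fv (enum n))

    -- Consistency is undecidable, so membership of enum n in the next stage is
    -- conditional on its being consistent relative to R.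
    Stage : ℕ → Formula → Set
    Stage zero    φ = φ ≡ ¬' goal
    Stage (suc n) φ = (Stage n ,, henkin (witness n) n) φ
                    ⊎ φ ≡ enum n × (Der (Stage n ,, henkin (witness n) n ,, enum n) ⊥' → R)

    Stage-fv : ∀ n {φ} → Stage n φ → fv φ ℕ.≤ stageFv n
    Stage-fv zero    ≡.refl = ℕ.≤-refl
    Stage-fv (suc n) (inj₁ (inj₁ h))    = ℕ.≤-trans (Stage-fv n h) (ℕ.m≤m⊔n _ _)
    Stage-fv (suc n) (inj₁ (inj₂ ≡.refl)) = ℕ.≤-trans (ℕ.m≤m⊔n _ (fv (enum n))) (ℕ.m≤n⊔m (stageFv n) _)
    Stage-fv (suc n) (inj₂ (≡.refl , _))  = ℕ.≤-trans (ℕ.m≤n⊔m (fv (henkin (witness n) n)) _)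
            (ℕ.m≤n⊔m (stageFv n) _)

    -- Whether `C` holds is undecidable, but whether a given finite derivation appeals to χ is not,
    -- and any such appeal carries a proof of `C`.
    split : ∀ {S χ φ} {C : Set} → Der (λ ψ → S ψ ⊎ ψ ≡ χ × C) φ → C ⊎ Der S φ
    split (thm d) = inj₂ (thm d)
    split (hyp (inj₁ h)) = inj₂ (hyp h)
    split (hyp (inj₂ (_ , c))) = inj₁ c
    split (mp d e) with split d | split e
    ... | inj₁ c | _      = inj₁ c
    ... | inj₂ _ | inj₁ c = inj₁ c
    ... | inj₂ d | inj₂ e = inj₂ (mp d e)

    ¬⇒-fst : ∀ {S φ ψ} → Der S (¬' (φ ⇒ ψ)) → Der S φ
    ¬⇒-fst d = raa (mp (weaken inj₁ d)
            (deduction (efq (mp (hyp (inj₁ (inj₂ ≡.refl))) (hyp (inj₂ ≡.refl))))))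

    ¬⇒-snd : ∀ {S φ ψ} → Der S (¬' (φ ⇒ ψ)) → Der S (¬' ψ)
    ¬⇒-snd d = deduction (mp (weaken inj₁ d) (const⇒ (hyp (inj₂ ≡.refl))))

    consistent : ∀ n → Der (Stage n) ⊥' → R
    consistent zero d =
      ⊢-Der (mp (thm (ax-DN goal)) (deduction (weaken inj₂ d)))
    consistent (suc n) d with split d
    ... | inj₁ c = c (weaken (λ { (inj₁ h) → inj₁ h ; (inj₂ (e , _)) → inj₂ e }) d)
    ... | inj₂ e = consistent n (mp (¬⇒-snd ¬h)
        (∀-intro (witness n) (λ h → ℕ.≤-trans (Stage-fv n h) (ℕ.m≤m⊔n _ _)) (ℕ.m≤n⊔m (stageFv n) _)
                (¬⇒-fst ¬h)))
      where ¬h = deduction e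

    U : Formula → Set
    U φ = ∃ λ n → Stage n φ

    Stage-mono : ∀ {n m φ} → n ℕ.≤′ m → Stage n φ → Stage m φ
    Stage-mono ℕ.≤′-refl     h = h
    Stage-mono (ℕ.≤′-step p) h = inj₁ (inj₁ (Stage-mono p h))

    compact : ∀ {φ} → Der U φ → ∃ λ n → Der (Stage n) φ
    compact (thm d) = 0 , thm d
    compact (hyp (n , h)) = n , hyp h
    compact (mp d e) with compact d | compact e
    ... | n , d | m , e = n ℕ.⊔ m
      , mp (weaken (Stage-mono (ℕ.≤⇒≤′ (ℕ.m≤m⊔n n m))) d)
           (weaken (Stage-mono (ℕ.≤⇒≤′ (ℕ.m≤n⊔m n m))) e)

    U-consistent : Der U ⊥' → R
    U-consistent d with compact d
    ... | n , e = consistent n e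

    -- With `U-consistent`, this makes provability of the goal equivalent to inconsistency of `U`,
    -- which is what the interpretation of `⊥'` in the term model relies on.
    U-explodes : ∀ {φ} → R → Der U φ
    U-explodes r = efq (mp (hyp (0 , ≡.refl)) (thm r))

    -- The formula was offered at the stage given by its number. A refutation from that stage is
    -- also one from `U`, so the hypothesis meets the condition for admission.
    maximal : ∀ φ → (Der (U ,, φ) ⊥' → R) → Der U φ
    maximal φ f with enum-surjective φ
    ... | n , ≡.refl = hyp (suc n , inj₂ (≡.refl , λ d → f (weaken into d)))
      where
      into : ∀ {ψ} → (Stage n ,, henkin (witness n) n ,, enum n) ψ → (U ,, enum n) ψ
      into (inj₁ h) = inj₁ (suc n , inj₁ h)
      into (inj₂ e) = inj₂ e

    U-⇒ : ∀ {φ ψ} → (Der U φ → Der U ψ) → Der U (φ ⇒ ψ)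
    U-⇒ f = maximal _ λ d → U-consistent (mp (¬⇒-snd (deduction d)) (f (¬⇒-fst (deduction d))))

    U-∀ : ∀ {φ} → (∀ t → Der U (φ [ t ]₀)) → Der U (∀' φ)
    U-∀ {φ} f with enum-surjective φ
    ... | n , ≡.refl = mp (hyp (suc n , inj₁ (inj₂ ≡.refl))) (f _)

    U-stable : ∀ {φ} → ((Der U φ → R) → R) → Der U φ
    U-stable {φ} f = maximal φ λ d → f λ e → U-consistent (mp (deduction d) e)

    M : Structure
    M = record
      { D = Term ; 0ᴹ = `0 ; 1ᴹ = `1 ; _+ᴹ_ = _`+_ ; _*ᴹ_ = _`*_
      ; _≈_ = λ t u → Der U (t ≐ u) ; _<ᴹ_ = λ t u → Der U (t ≺ u) ; R = R }

    open Structure M hiding (R; D)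

    ⟦⟧ᵀ-sub : ∀ ρ t → ⟦ t ⟧ᵀ ρ ≡ subT ρ t
    ⟦⟧ᵀ-sub ρ (var x)  = ≡.refl
    ⟦⟧ᵀ-sub ρ `0       = ≡.refl
    ⟦⟧ᵀ-sub ρ `1       = ≡.refl
    ⟦⟧ᵀ-sub ρ (t `+ u) = ≡.cong₂ _`+_ (⟦⟧ᵀ-sub ρ t) (⟦⟧ᵀ-sub ρ u)
    ⟦⟧ᵀ-sub ρ (t `* u) = ≡.cong₂ _`*_ (⟦⟧ᵀ-sub ρ t) (⟦⟧ᵀ-sub ρ u)

    truth→ : ∀ φ ρ → ⟦ φ ⟧ ρ → Der U (sub ρ φ)
    truth← : ∀ φ ρ → Der U (sub ρ φ) → ⟦ φ ⟧ ρ
    truth→ ⊥'      ρ r = U-explodes r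
    truth→ (t ≐ u) ρ d = ≡.subst (Der U) (≡.cong₂ _≐_ (⟦⟧ᵀ-sub ρ t) (⟦⟧ᵀ-sub ρ u)) d
    truth→ (t ≺ u) ρ d = ≡.subst (Der U) (≡.cong₂ _≺_ (⟦⟧ᵀ-sub ρ t) (⟦⟧ᵀ-sub ρ u)) d
    truth→ (φ ⇒ ψ) ρ f = U-⇒ λ d → truth→ ψ ρ (f (truth← φ ρ d))
    truth→ (∀' φ)  ρ f = U-∀ λ t → ≡.subst (Der U) (≡.sym (sub-ext-σ₀ ρ t φ)) (truth→ φ (t ◂ ρ) (f t))
    truth← ⊥'      ρ d = U-consistent d
    truth← (t ≐ u) ρ d = ≡.subst (Der U) (≡.sym (≡.cong₂ _≐_ (⟦⟧ᵀ-sub ρ t) (⟦⟧ᵀ-sub ρ u))) d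
    truth← (t ≺ u) ρ d = ≡.subst (Der U) (≡.sym (≡.cong₂ _≺_ (⟦⟧ᵀ-sub ρ t) (⟦⟧ᵀ-sub ρ u))) d
    truth← (φ ⇒ ψ) ρ d x = truth← ψ ρ (mp d (truth→ φ ρ x))
    truth← (∀' φ)  ρ d t =
      truth← φ (t ◂ ρ) (≡.subst (Der U) (sub-ext-σ₀ ρ t φ) (mp (thm (ax-∀E _ t)) d))

    isModel : IsModel T M
    isModel = record
      { ≈-stable  = U-stable
      ; <-stable  = U-stable
      ; ≈-refl    = thm (ax-refl _)
      ; ≈-replace = λ φ ρ {x} {y} e h → truth← φ (y ◂ ρ) (≡.subst (Der U) (sub-ext-σ₀ ρ y φ)
          (mp (mp (thm (ax-eq (sub (ext ρ) φ) x y)) e)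
              (≡.subst (Der U) (≡.sym (sub-ext-σ₀ ρ x φ)) (truth→ φ (x ◂ ρ) h))))
      ; sound     = λ {φ} a ρ → truth← φ ρ (thm (⊢-sub ρ (ax a)))
      }

  -- Truth under the identity environment makes φ itself derivable from `U`, which contains its
  -- negation from stage 0. Falsity of the model being provability of φ, the contradiction is the
  -- desired proof.
  complete : ∀ {φ} → (∀ M → IsModel T M → ∀ ρ → Structure.⟦_⟧ M φ ρ) → T ⊢ φ
  complete {φ} valid =
    U-consistent (mp (hyp (0 , ≡.refl))
            (≡.subst (Der U) (sub-var φ) (truth→ φ var (valid M isModel var))))
    where open Lindenbaum φ

-- Formulas and their classical semantics

-- The connectives that Defs encodes by ⊥', ⇒ and ∀' are primitive here, so
-- that they can be given a readable (but equivalent) meaning.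
infixr 4 _&_ _or_
infixr 3 _imp_
data Formula⁺ : Set where
  eq lt         : Term → Term → Formula⁺
  fls           : Formula⁺
  _&_ _or_ _imp_ : Formula⁺ → Formula⁺ → Formula⁺
  all ex        : Formula⁺ → Formula⁺
  all< ex<      : Term → Formula⁺ → Formula⁺

⌜_⌝ : Formula⁺ → Formula
⌜ eq t u ⌝   = t ≐ u
⌜ lt t u ⌝   = t ≺ u
⌜ fls ⌝      = ⊥'
⌜ N & N' ⌝   = ⌜ N ⌝ ∧' ⌜ N' ⌝
⌜ N or N' ⌝  = ⌜ N ⌝ ∨' ⌜ N' ⌝
⌜ N imp N' ⌝ = ⌜ N ⌝ ⇒ ⌜ N' ⌝
⌜ all N ⌝    = ∀' ⌜ N ⌝
⌜ ex N ⌝     = ∃' ⌜ N ⌝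
⌜ all< t N ⌝ = ∀' ((var zero ≺ renT suc t) ⇒ ⌜ N ⌝)
⌜ ex< t N ⌝  = ∃' ((var zero ≺ renT suc t) ∧' ⌜ N ⌝)

-- Boolean, so that for a concrete formula the side condition of `induction` computes to the unit
-- type and is filled in silently.
isΔ₀ : Formula⁺ → Bool
isΔ₀ (eq t u)   = true
isΔ₀ (lt t u)   = true
isΔ₀ fls        = true
isΔ₀ (N & N')   = isΔ₀ N ∧ isΔ₀ N'
isΔ₀ (N or N')  = isΔ₀ N ∧ isΔ₀ N'
isΔ₀ (N imp N') = isΔ₀ N ∧ isΔ₀ N'
isΔ₀ (all N)    = false
isΔ₀ (ex N)     = false
isΔ₀ (all< t N) = isΔ₀ N
isΔ₀ (ex< t N)  = isΔ₀ N

isΣ₁ : Formula⁺ → Bool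
isΣ₁ (ex N) = isΣ₁ N
isΣ₁ N      = isΔ₀ N

toΔ₀ : ∀ N → T (isΔ₀ N) → Δ₀ ⌜ N ⌝
toΔ₀ (eq t u)   p = ≐-Δ₀ t u
toΔ₀ (lt t u)   p = ≺-Δ₀ t u
toΔ₀ fls        p = ⊥-Δ₀
toΔ₀ (N & N')   p = let q , r = Equivalence.to T-∧ p in
  ⇒-Δ₀ (⇒-Δ₀ (toΔ₀ N q) (⇒-Δ₀ (toΔ₀ N' r) ⊥-Δ₀)) ⊥-Δ₀
toΔ₀ (N or N')  p = let q , r = Equivalence.to T-∧ p in
  ⇒-Δ₀ (⇒-Δ₀ (toΔ₀ N q) ⊥-Δ₀) (toΔ₀ N' r)
toΔ₀ (N imp N') p = let q , r = Equivalence.to T-∧ p in ⇒-Δ₀ (toΔ₀ N q) (toΔ₀ N' r)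
toΔ₀ (all< t N) p = ∀<-Δ₀ t (toΔ₀ N p)
toΔ₀ (ex< t N)  p = ∃<-Δ₀ t (toΔ₀ N p)

toΣ₁ : ∀ N → T (isΣ₁ N) → Σ₁ ⌜ N ⌝
toΣ₁ (ex N)         p = ∃-Σ₁ (toΣ₁ N p)
toΣ₁ N@(eq _ _)     p = Δ₀-Σ₁ (toΔ₀ N p)
toΣ₁ N@(lt _ _)     p = Δ₀-Σ₁ (toΔ₀ N p)
toΣ₁ N@fls          p = Δ₀-Σ₁ (toΔ₀ N p)
toΣ₁ N@(_ & _)      p = Δ₀-Σ₁ (toΔ₀ N p)
toΣ₁ N@(_ or _)     p = Δ₀-Σ₁ (toΔ₀ N p)
toΣ₁ N@(_ imp _)    p = Δ₀-Σ₁ (toΔ₀ N p)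
toΣ₁ N@(all< _ _)   p = Δ₀-Σ₁ (toΔ₀ N p)
toΣ₁ N@(ex< _ _)    p = Δ₀-Σ₁ (toΔ₀ N p)

-- Predicates are written once over an abstract logic; the instance
-- `syntactic` turns them into formulas and the instance `semantic` into
-- the meaning of these formulas in a model, definitionally.
record Logic (ℓ : Level) : Set (lsuc ℓ) where
  infixl 7 _⊗_
  infixl 6 _⊕_
  infix  5 _≗_ _⋖_
  infixr 4 _∧∧_ _∨∨_
  infixr 3 _⊃_
  field
    Tm          : Set
    Fm          : Set ℓ
    𝟘 𝟙         : Tm
    _⊕_ _⊗_     : Tm → Tm → Tm
    _≗_ _⋖_     : Tm → Tm → Fm
    ff          : Fm
    _∧∧_ _∨∨_ _⊃_ : Fm → Fm → Fm
    A∀ E∃       : (Tm → Fm) → Fm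
    A< E<       : Tm → (Tm → Fm) → Fm

syntactic : Logic 0ℓ
syntactic = record
  { Tm = TB ; Fm = ℕ → Formula⁺ ; 𝟘 = 0B ; 𝟙 = 1B ; _⊕_ = _+B_ ; _⊗_ = _*B_
  ; _≗_ = λ t u d → eq (t d) (u d) ; _⋖_ = λ t u d → lt (t d) (u d)
  ; ff = λ d → fls
  ; _∧∧_ = λ φ ψ d → φ d & ψ d ; _∨∨_ = λ φ ψ d → φ d or ψ d ; _⊃_ = λ φ ψ d → φ d imp ψ d
  ; A∀ = λ f d → all (f (lvl d) (suc d)) ; E∃ = λ f d → ex (f (lvl d) (suc d))
  ; A< = λ t f d → all< (t d) (f (lvl d) (suc d)) ; E< = λ t f d → ex< (t d) (f (lvl d) (suc d))
  }

module Classical (R : Set) where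

  -- Double negation relative to `R`. Its `do` blocks are classical arguments, and a branch that
  -- reaches falsity ends in `λ _ → r` with `r` in `R`.
  K : Set → Set
  K A = (A → R) → R

  return : ∀ {A} → A → K A
  return a k = k a

  infixl 1 _>>=_
  _>>=_ : ∀ {A B} → K A → (A → K B) → K B
  (m >>= f) k = m λ a → f a k

  lem : ∀ A → K (A ⊎ (A → R))
  lem A k = k (inj₂ λ a → k (inj₁ a))

module Semantics (M : Structure) {Th : Theory} (isM : IsModel Th M) where

  open Structure M public
  open IsModel isM public
  open Classical R public

  semantic : Logic (lsuc 0ℓ)
  semantic = record
    { Tm = D ; Fm = Set ; 𝟘 = 0ᴹ ; 𝟙 = 1ᴹ ; _⊕_ = _+ᴹ_ ; _⊗_ = _*ᴹ_
    ; _≗_ = _≈_ ; _⋖_ = _<ᴹ_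
    ; ff = R
    ; _∧∧_ = _×_ ; _∨∨_ = λ A B → K (A ⊎ B) ; _⊃_ = λ A B → A → B
    ; A∀ = λ P → ∀ x → P x ; E∃ = λ P → K (Σ D P)
    ; A< = λ t P → ∀ x → x <ᴹ t → P x ; E< = λ t P → K (Σ D λ x → x <ᴹ t × P x)
    }

  ⟦_⟧⁺ : Formula⁺ → Env → Set
  ⟦ eq t u ⟧⁺   ρ = ⟦ t ⟧ᵀ ρ ≈ ⟦ u ⟧ᵀ ρ
  ⟦ lt t u ⟧⁺   ρ = ⟦ t ⟧ᵀ ρ <ᴹ ⟦ u ⟧ᵀ ρ
  ⟦ fls ⟧⁺      ρ = R
  ⟦ N & N' ⟧⁺   ρ = ⟦ N ⟧⁺ ρ × ⟦ N' ⟧⁺ ρ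
  ⟦ N or N' ⟧⁺  ρ = K (⟦ N ⟧⁺ ρ ⊎ ⟦ N' ⟧⁺ ρ)
  ⟦ N imp N' ⟧⁺ ρ = ⟦ N ⟧⁺ ρ → ⟦ N' ⟧⁺ ρ
  ⟦ all N ⟧⁺    ρ = ∀ x → ⟦ N ⟧⁺ (x ◂ ρ)
  ⟦ ex N ⟧⁺     ρ = K (Σ D λ x → ⟦ N ⟧⁺ (x ◂ ρ))
  ⟦ all< t N ⟧⁺ ρ = ∀ x → x <ᴹ ⟦ t ⟧ᵀ ρ → ⟦ N ⟧⁺ (x ◂ ρ)
  ⟦ ex< t N ⟧⁺  ρ = K (Σ D λ x → x <ᴹ ⟦ t ⟧ᵀ ρ × ⟦ N ⟧⁺ (x ◂ ρ))

  -- Disjunctions and existentials are read with `K` in front, atoms are stable in a model, and the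
  -- other connectives inherit stability.
  stable : ∀ N ρ → K (⟦ N ⟧⁺ ρ) → ⟦ N ⟧⁺ ρ
  stable (eq t u)   ρ h = ≈-stable h
  stable (lt t u)   ρ h = <-stable h
  stable fls        ρ h = h id
  stable (N & N')   ρ h = stable N ρ (λ k → h (k ∘ proj₁)) , stable N' ρ (λ k → h (k ∘ proj₂))
  stable (N or N')  ρ h = λ k → h λ x → x k
  stable (N imp N') ρ h = λ x → stable N' ρ λ k → h λ f → k (f x)
  stable (all N)    ρ h = λ x → stable N (x ◂ ρ) λ k → h λ f → k (f x)
  stable (ex N)     ρ h = λ k → h λ x → x k
  stable (all< t N) ρ h = λ x p → stable N (x ◂ ρ) λ k → h λ f → k (f x p)
  stable (ex< t N)  ρ h = λ k → h λ x → x k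

  ⟦⟧ᵀ-ren : ∀ t x ρ → ⟦ renT suc t ⟧ᵀ (x ◂ ρ) ≡ ⟦ t ⟧ᵀ ρ
  ⟦⟧ᵀ-ren (var y)  x ρ = ≡.refl
  ⟦⟧ᵀ-ren `0       x ρ = ≡.refl
  ⟦⟧ᵀ-ren `1       x ρ = ≡.refl
  ⟦⟧ᵀ-ren (t `+ u) x ρ = ≡.cong₂ _+ᴹ_ (⟦⟧ᵀ-ren t x ρ) (⟦⟧ᵀ-ren u x ρ)
  ⟦⟧ᵀ-ren (t `* u) x ρ = ≡.cong₂ _*ᴹ_ (⟦⟧ᵀ-ren t x ρ) (⟦⟧ᵀ-ren u x ρ)

  to   : ∀ N ρ → ⟦ N ⟧⁺ ρ → ⟦ ⌜ N ⌝ ⟧ ρ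
  from : ∀ N ρ → ⟦ ⌜ N ⌝ ⟧ ρ → ⟦ N ⟧⁺ ρ
  to (eq t u)   ρ h = h
  to (lt t u)   ρ h = h
  to fls        ρ h = h
  to (N & N')   ρ (h , h') k = k (to N ρ h) (to N' ρ h')
  -- The encoded disjunction is an implication into its right side, so stability of that side
  -- removes the `K`.
  to (N or N')  ρ h k = to N' ρ (stable N' ρ λ k' → h [ k ∘ to N ρ , k' ]′)
  to (N imp N') ρ h x = to N' ρ (h (from N ρ x))
  to (all N)    ρ h x = to N (x ◂ ρ) (h x)
  to (ex N)     ρ h k = h λ { (x , p) → k x (to N (x ◂ ρ) p) }
  to (all< t N) ρ h x p = to N (x ◂ ρ) (h x (≡.subst (x <ᴹ_) (⟦⟧ᵀ-ren t x ρ) p))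
  to (ex< t N)  ρ h k = h λ { (x , p , q) →
    k x λ k' → k' (≡.subst (x <ᴹ_) (≡.sym (⟦⟧ᵀ-ren t x ρ)) p) (to N (x ◂ ρ) q) }
  from (eq t u)   ρ h = h
  from (lt t u)   ρ h = h
  from fls        ρ h = h
  from (N & N')   ρ h = stable N ρ (λ k → h λ x _ → k (from N ρ x))
                      , stable N' ρ (λ k → h λ _ x → k (from N' ρ x))
  from (N or N')  ρ h k = k (inj₂ (from N' ρ (h λ x → k (inj₁ (from N ρ x)))))
  from (N imp N') ρ h x = from N' ρ (h (to N ρ x))
  from (all N)    ρ h x = from N (x ◂ ρ) (h x)
  from (ex N)     ρ h k = h λ x p → k (x , from N (x ◂ ρ) p)
  from (all< t N) ρ h x p = from N (x ◂ ρ) (h x (≡.subst (x <ᴹ_) (≡.sym (⟦⟧ᵀ-ren t x ρ)) p))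
  from (ex< t N)  ρ h k = h λ x h' → h' λ p q →
    k (x , ≡.subst (x <ᴹ_) (⟦⟧ᵀ-ren t x ρ) p , from N (x ◂ ρ) q)

  replace : ∀ N ρ {x y} → x ≈ y → ⟦ N ⟧⁺ (x ◂ ρ) → ⟦ N ⟧⁺ (y ◂ ρ)
  replace N ρ e h = from N _ (≈-replace ⌜ N ⌝ ρ e (to N _ h))

  ⟦⟧ᵀ-cong : ∀ t {ρ ρ'} → (∀ x → ρ x ≡ ρ' x) → ⟦ t ⟧ᵀ ρ ≡ ⟦ t ⟧ᵀ ρ'
  ⟦⟧ᵀ-cong (var x)  h = h x
  ⟦⟧ᵀ-cong `0       h = ≡.refl
  ⟦⟧ᵀ-cong `1       h = ≡.refl
  ⟦⟧ᵀ-cong (t `+ u) h = ≡.cong₂ _+ᴹ_ (⟦⟧ᵀ-cong t h) (⟦⟧ᵀ-cong u h)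
  ⟦⟧ᵀ-cong (t `* u) h = ≡.cong₂ _*ᴹ_ (⟦⟧ᵀ-cong t h) (⟦⟧ᵀ-cong u h)

  ⟦⟧ᵀ-sub : ∀ σ t ρ → ⟦ subT σ t ⟧ᵀ ρ ≡ ⟦ t ⟧ᵀ (λ x → ⟦ σ x ⟧ᵀ ρ)
  ⟦⟧ᵀ-sub σ (var x)  ρ = ≡.refl
  ⟦⟧ᵀ-sub σ `0       ρ = ≡.refl
  ⟦⟧ᵀ-sub σ `1       ρ = ≡.refl
  ⟦⟧ᵀ-sub σ (t `+ u) ρ = ≡.cong₂ _+ᴹ_ (⟦⟧ᵀ-sub σ t ρ) (⟦⟧ᵀ-sub σ u ρ)
  ⟦⟧ᵀ-sub σ (t `* u) ρ = ≡.cong₂ _*ᴹ_ (⟦⟧ᵀ-sub σ t ρ) (⟦⟧ᵀ-sub σ u ρ)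

  ⟦⟧-sub→ : ∀ φ σ {ρ ρ'} → (∀ x → ⟦ σ x ⟧ᵀ ρ ≡ ρ' x) → ⟦ sub σ φ ⟧ ρ → ⟦ φ ⟧ ρ'
  ⟦⟧-sub← : ∀ φ σ {ρ ρ'} → (∀ x → ⟦ σ x ⟧ᵀ ρ ≡ ρ' x) → ⟦ φ ⟧ ρ' → ⟦ sub σ φ ⟧ ρ

  ⟦ext⟧ : ∀ σ {ρ ρ'} → (∀ x → ⟦ σ x ⟧ᵀ ρ ≡ ρ' x) → ∀ d x → ⟦ ext σ x ⟧ᵀ (d ◂ ρ) ≡ (d ◂ ρ') x
  ⟦ext⟧ σ h d zero    = ≡.refl
  ⟦ext⟧ σ h d (suc x) = ≡.trans (⟦⟧ᵀ-ren (σ x) d _) (h x)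

  ⟦subT⟧ : ∀ t σ {ρ ρ'} → (∀ x → ⟦ σ x ⟧ᵀ ρ ≡ ρ' x) → ⟦ subT σ t ⟧ᵀ ρ ≡ ⟦ t ⟧ᵀ ρ'
  ⟦subT⟧ t σ h = ≡.trans (⟦⟧ᵀ-sub σ t _) (⟦⟧ᵀ-cong t h)

  ⟦⟧-sub→ ⊥'      σ h p = p
  ⟦⟧-sub→ (t ≐ u) σ h p = ≡.subst id (≡.cong₂ _≈_ (⟦subT⟧ t σ h) (⟦subT⟧ u σ h)) p
  ⟦⟧-sub→ (t ≺ u) σ h p = ≡.subst id (≡.cong₂ _<ᴹ_ (⟦subT⟧ t σ h) (⟦subT⟧ u σ h)) p
  ⟦⟧-sub→ (φ ⇒ ψ) σ h p x = ⟦⟧-sub→ ψ σ h (p (⟦⟧-sub← φ σ h x))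
  ⟦⟧-sub→ (∀' φ)  σ h p d = ⟦⟧-sub→ φ (ext σ) (⟦ext⟧ σ h d) (p d)
  ⟦⟧-sub← ⊥'      σ h p = p
  ⟦⟧-sub← (t ≐ u) σ h p = ≡.subst id (≡.sym (≡.cong₂ _≈_ (⟦subT⟧ t σ h) (⟦subT⟧ u σ h))) p
  ⟦⟧-sub← (t ≺ u) σ h p = ≡.subst id (≡.sym (≡.cong₂ _<ᴹ_ (⟦subT⟧ t σ h) (⟦subT⟧ u σ h))) p
  ⟦⟧-sub← (φ ⇒ ψ) σ h p x = ⟦⟧-sub← ψ σ h (p (⟦⟧-sub→ φ σ h x))
  ⟦⟧-sub← (∀' φ)  σ h p d = ⟦⟧-sub← φ (ext σ) (⟦ext⟧ σ h d) (p d)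

-- The predicates of Defs with the same formulas: ⌜ Total ⌝ is AckTotal.
module Encoding {ℓ} (L : Logic ℓ) where
  open Logic L

  Pair : Tm → Tm → Tm → Fm
  Pair a b c = (c ⊕ c) ≗ ((a ⊕ b) ⊗ (a ⊕ b ⊕ 𝟙) ⊕ (b ⊕ b))

  Lth : Tm → Tm → Fm
  Lth s l = E< (s ⊕ 𝟙) λ w → Pair l w s

  Ent : Tm → Tm → Tm → Fm
  Ent s i v =
    E< (s ⊕ 𝟙) λ l → E< (s ⊕ 𝟙) λ w →
    E< (s ⊕ 𝟙) λ a → E< (s ⊕ 𝟙) λ b → E< (s ⊕ 𝟙) λ q →
    let dv = 𝟙 ⊕ (i ⊕ 𝟙) ⊗ b in
    Pair l w s ∧∧ Pair a b w ∧∧ (v ⋖ dv) ∧∧ (a ≗ (q ⊗ dv ⊕ v))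

  Trip : Tm → Tm → Tm → Tm → Fm
  Trip a b c t = E< (t ⊕ 𝟙) λ w → Pair b c w ∧∧ Pair a w t

  GoodCode : Tm → Tm → Fm
  GoodCode s j =
    E< (s ⊕ 𝟙) λ t → E< (s ⊕ 𝟙) λ a → E< (s ⊕ 𝟙) λ b → E< (s ⊕ 𝟙) λ c →
      Ent s j t ∧∧ Trip a b c t ∧∧
      (((a ≗ 𝟘) ∧∧ (c ≗ (b ⊕ 𝟙)))
      ∨∨ ((𝟘 ⋖ a) ∧∧ (b ≗ 𝟘) ∧∧
          (E< j λ j' → E< (s ⊕ 𝟙) λ t' → E< (s ⊕ 𝟙) λ a' →
             Ent s j' t' ∧∧ ((a' ⊕ 𝟙) ≗ a) ∧∧ Trip a' 𝟙 c t'))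
      ∨∨ ((𝟘 ⋖ a) ∧∧ (𝟘 ⋖ b) ∧∧
          (E< j λ j₁ → E< j λ j₂ →
           E< (s ⊕ 𝟙) λ t₁ → E< (s ⊕ 𝟙) λ t₂ →
           E< (s ⊕ 𝟙) λ a' → E< (s ⊕ 𝟙) λ b' → E< (s ⊕ 𝟙) λ r →
             Ent s j₁ t₁ ∧∧ Ent s j₂ t₂ ∧∧ ((a' ⊕ 𝟙) ≗ a) ∧∧ ((b' ⊕ 𝟙) ≗ b) ∧∧
             Trip a b' r t₁ ∧∧ Trip a' r c t₂)))

  AckGraph : Tm → Tm → Tm → Fm
  AckGraph m n k =
    E∃ λ s → E∃ λ l →
      Lth s l ∧∧ (A< l λ j → GoodCode s j) ∧∧
      (E< l λ j → E< (s ⊕ 𝟙) λ t → Ent s j t ∧∧ Trip m n k t)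

  Total : Fm
  Total = A∀ λ m → A∀ λ n → E∃ λ k → AckGraph m n k

module Encodingᶠ = Encoding syntactic

-- Arithmetic in a model of PΣ₁

module Arithmetic (M : Structure) (isM : IsModel PΣ₁ M) where

  open Semantics M isM public

  pa : ∀ {φ} → PA⁻ φ → ∀ ρ → ⟦ φ ⟧ ρ
  pa a = sound (iΣ₁ (base a))

  origin : Env
  origin _ = 0ᴹ

  ≈-sym : ∀ {x y} → x ≈ y → y ≈ x
  ≈-sym {x} e = ≈-replace (var 0 ≐ var 1) (x ◂ origin) e ≈-refl

  ≈-trans : ∀ {x y z} → x ≈ y → y ≈ z → x ≈ z
  ≈-trans {x} e f = ≈-replace (var 1 ≐ var 0) (x ◂ origin) f e

  +-cong' : ∀ {x y u v} → x ≈ y → u ≈ v → (x +ᴹ u) ≈ (y +ᴹ v)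
  +-cong' {x} {y} {u} {v} e f = ≈-trans
    (≈-replace (var 1 `+ var 2 ≐ var 0 `+ var 2) (x ◂ u ◂ origin) e ≈-refl)
    (≈-replace (var 2 `+ var 1 ≐ var 2 `+ var 0) (u ◂ y ◂ origin) f ≈-refl)

  *-cong' : ∀ {x y u v} → x ≈ y → u ≈ v → (x *ᴹ u) ≈ (y *ᴹ v)
  *-cong' {x} {y} {u} {v} e f = ≈-trans
    (≈-replace (var 1 `* var 2 ≐ var 0 `* var 2) (x ◂ u ◂ origin) e ≈-refl)
    (≈-replace (var 2 `* var 1 ≐ var 2 `* var 0) (u ◂ y ◂ origin) f ≈-refl)

  commutativeSemiring : CommutativeSemiring 0ℓ 0ℓ
  commutativeSemiring = record
    { Carrier = D ; _≈_ = _≈_ ; _+_ = _+ᴹ_ ; _*_ = _*ᴹ_ ; 0# = 0ᴹ ; 1# = 1ᴹ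
    ; isCommutativeSemiring = isCommutativeSemiringˡ (record
      { +-isCommutativeMonoid = record
        { isMonoid = record
          { isSemigroup = record
            { isMagma = record { isEquivalence = isEquivalence ; ∙-cong = +-cong' }
            ; assoc = pa Defs.+-assoc origin }
          ; identity = (λ x → ≈-trans (+-comm' 0ᴹ x) (+-0 x)) , +-0 }
        ; comm = +-comm' }
      ; *-isCommutativeMonoid = record
        { isMonoid = record
          { isSemigroup = record
            { isMagma = record { isEquivalence = isEquivalence ; ∙-cong = *-cong' }
            ; assoc = pa Defs.*-assoc origin }
          ; identity = (λ x → ≈-trans (*-comm' 1ᴹ x) (*-1 x)) , *-1 }
        ; comm = *-comm' }
      ; distribʳ = λ x y z → ≈-trans (*-comm' (y +ᴹ z) x)
          (≈-trans (pa Defs.distr origin x y z) (+-cong' (*-comm' x y) (*-comm' x z)))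
      ; zeroˡ = λ x → ≈-trans (*-comm' 0ᴹ x) (≈-stable λ k → pa Defs.+-id-*-0 origin x λ _ p → k p)
      })
    }
    where
    isEquivalence : IsEquivalence _≈_
    isEquivalence = record { refl = ≈-refl ; sym = ≈-sym ; trans = ≈-trans }
    +-comm' = pa Defs.+-comm origin
    *-comm' = pa Defs.*-comm origin
    *-1 = pa Defs.*-id origin
    +-0 : ∀ x → (x +ᴹ 0ᴹ) ≈ x
    +-0 x = ≈-stable λ k → pa Defs.+-id-*-0 origin x λ p _ → k p

  open CommutativeSemiring commutativeSemiring public
    using (_+_; _*_; 0#; 1#; +-cong; +-congˡ; +-congʳ; *-cong; *-congˡ; *-congʳ; refl; sym; trans; setoid;
           +-assoc; +-comm; *-assoc; *-comm; +-identityˡ; +-identityʳ; zeroˡ)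
  open import Algebra.Solver.Ring.NaturalCoefficients.Default commutativeSemiring public
    using (solve; _:+_; _:*_; _:=_; con)
  open import Relation.Binary.Reasoning.Setoid setoid public

  <-resp : ∀ {x y u v} → x ≈ y → u ≈ v → x <ᴹ u → y <ᴹ v
  <-resp {x} {y} {u} e f p =
    ≈-replace (var 1 ≺ var 0) (y ◂ origin) f (≈-replace (var 0 ≺ var 1) (u ◂ origin) e p)

  or-K : ∀ {A B} → ((A → R) → B) → K (A ⊎ B)
  or-K f k = k (inj₂ (f (k ∘ inj₁)))

  0-or-pos : ∀ x → K (0# <ᴹ x ⊎ 0# ≈ x)
  0-or-pos x = or-K (pa Defs.0-least origin x)

  diff : ∀ {x y} → x <ᴹ y → K (Σ D λ z → x + z ≈ y)
  diff p k = pa Defs.<-diff origin _ _ p λ z q → k (z , q)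

  <-trans : ∀ {x y z} → x <ᴹ y → y <ᴹ z → x <ᴹ z
  <-trans p q = pa Defs.<-trans origin _ _ _ λ f → f p q

  0<1 : 0# <ᴹ 1#
  0<1 = <-stable λ k → pa Defs.0<1-disc origin λ p _ → k p

  0<suc : ∀ z → 0# <ᴹ z + 1#
  0<suc z = <-stable do
    inj₁ 0<z ← 0-or-pos z
      where inj₂ 0≈z → return (<-resp refl (trans (sym (+-identityˡ 1#)) (+-congʳ 0≈z)) 0<1)
    return (<-trans 0<1 (<-resp (+-identityˡ 1#) refl (pa Defs.<-+ origin 0# z 1# 0<z)))

  <-intro : ∀ {x y} z → x + (z + 1#) ≈ y → x <ᴹ y
  <-intro {x} z e = <-resp (+-identityˡ x) (trans (+-comm (z + 1#) x) e)
    (pa Defs.<-+ origin 0# (z + 1#) x (0<suc z))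

  irrefl : ∀ {x y} → x ≈ y → x <ᴹ y → R
  irrefl {x} e p = pa Defs.<-irrefl origin x (<-resp refl (sym e) p)

  <-elim : ∀ {x y} → x <ᴹ y → K (Σ D λ z → x + (z + 1#) ≈ y)
  <-elim {x} {y} p = do
    w , e ← diff p
    inj₁ 0<w ← 0-or-pos w
      where inj₂ 0≈w → λ _ → irrefl (trans (sym (+-identityʳ x)) (trans (+-congˡ 0≈w) e)) p
    inj₁ 1<w ← (λ k → pa Defs.0<1-disc origin λ _ disc → or-K (disc w 0<w) k)
      where inj₂ 1≈w → return (0# , trans (+-congˡ (trans (+-identityˡ 1#) 1≈w)) e)
    z , f ← diff 1<w
    return (z , trans (+-congˡ (trans (+-comm z 1#) f)) e)

  trichotomy : ∀ x y → K (x <ᴹ y ⊎ x ≈ y ⊎ y <ᴹ x)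
  trichotomy x y k = or-K (λ ¬p → or-K (pa Defs.trichot origin x y ¬p)) λ
    { (inj₁ p) → k (inj₁ p) ; (inj₂ q) → q (k ∘ inj₂) }

  infix 4 _≤_
  _≤_ : D → D → Set
  x ≤ y = K (Σ D λ z → x + z ≈ y)

  wit : ∀ {x y} z → x + z ≈ y → x ≤ y
  wit z e = return (z , e)

  ≤⇒<+1 : ∀ {x y} → x ≤ y → x <ᴹ y + 1#
  ≤⇒<+1 p = <-stable do
    z , e ← p
    return (<-intro z (trans (sym (+-assoc _ z 1#)) (+-congʳ e)))

  +-cancelʳ : ∀ {x y} z → x + z ≈ y + z → x ≈ y
  +-cancelʳ {x} {y} z e = ≈-stable (trichotomy x y >>= λ
    { (inj₁ p)        → λ _ → irrefl e (pa Defs.<-+ origin x y z p)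
    ; (inj₂ (inj₁ p)) → return p
    ; (inj₂ (inj₂ p)) → λ _ → irrefl (sym e) (pa Defs.<-+ origin y x z p) })

  +-cancelˡ : ∀ x {y z} → x + y ≈ x + z → y ≈ z
  +-cancelˡ x {y} {z} e = +-cancelʳ x (trans (+-comm y x) (trans e (+-comm x z)))

  <+1⇒≤ : ∀ {x y} → x <ᴹ y + 1# → x ≤ y
  <+1⇒≤ {x} p = do
    z , e ← <-elim p
    return (z , +-cancelʳ 1# (trans (+-assoc x z 1#) e))

  <⇒≤ : ∀ {x y} → x <ᴹ y → x ≤ y
  <⇒≤ p = do
    z , e ← <-elim p
    return (z + 1# , e)

  ≤-trans : ∀ {x y z} → x ≤ y → y ≤ z → x ≤ z
  ≤-trans {x} p q = do
    a , e ← p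
    b , f ← q
    return (a + b , trans (sym (+-assoc x a b)) (trans (+-congʳ e) f))

  ≤-reflexive : ∀ {x y} → x ≈ y → x ≤ y
  ≤-reflexive e = wit 0# (trans (+-identityʳ _) e)

  ≤-refl : ∀ {x} → x ≤ x
  ≤-refl = ≤-reflexive refl

  0≤ : ∀ {x} → 0# ≤ x
  0≤ {x} = wit x (+-identityˡ x)

  <-≤-trans : ∀ {x y z} → x <ᴹ y → y ≤ z → x <ᴹ z
  <-≤-trans {x} p q = <-stable do
    a , e ← <-elim p
    b , f ← q
    return (<-intro (a + b) (begin
      x + (a + b + 1#)   ≈⟨ solve 3 (λ x a b → x :+ (a :+ b :+ con 1)
              := x :+ (a :+ con 1) :+ b) refl x a b ⟩
      x + (a + 1#) + b   ≈⟨ +-congʳ e ⟩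
      _ + b              ≈⟨ f ⟩
      _                  ∎))

  ≤-<-trans : ∀ {x y z} → x ≤ y → y <ᴹ z → x <ᴹ z
  ≤-<-trans {x} p q = <-stable do
    a , e ← p
    b , f ← <-elim q
    return (<-intro (a + b) (trans (solve 3 (λ x a b → x :+ (a :+ b :+ con 1)
            := x :+ a :+ (b :+ con 1)) refl x a b)
                                   (trans (+-congʳ e) f)))

  x≤x+y : ∀ {x y} → x ≤ x + y
  x≤x+y {y = y} = wit y refl

  y≤x+y : ∀ {x y} → y ≤ x + y
  y≤x+y {x} {y} = wit x (+-comm y x)

  <+1 : ∀ {x} → x <ᴹ x + 1#
  <+1 = ≤⇒<+1 ≤-refl

  ≤-or-> : ∀ x y → K (x ≤ y ⊎ y <ᴹ x)
  ≤-or-> x y = trichotomy x y >>= λ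
    { (inj₁ p)        → return (inj₁ (<⇒≤ p))
    ; (inj₂ (inj₁ p)) → return (inj₁ (≤-reflexive p))
    ; (inj₂ (inj₂ p)) → return (inj₂ p) }

  <+1-cases : ∀ {x y} → x <ᴹ y + 1# → K (x <ᴹ y ⊎ x ≈ y)
  <+1-cases {x} {y} p = trichotomy x y >>= λ
    { (inj₁ q)        → return (inj₁ q)
    ; (inj₂ (inj₁ q)) → return (inj₂ q)
    ; (inj₂ (inj₂ q)) → λ _ → irrefl refl (<-≤-trans q (<+1⇒≤ p)) }

  ≮0 : ∀ {x} → x <ᴹ 0# → R
  ≮0 {x} p = <-elim p λ { (z , e) →
    irrefl (sym (trans (+-assoc x z 1#) e)) (0<suc (x + z)) }

  0-or-suc : ∀ x → K (x ≈ 0# ⊎ Σ D λ y → x ≈ y + 1#)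
  0-or-suc x = do
    inj₁ p ← 0-or-pos x
      where inj₂ q → return (inj₁ (sym q))
    z , e ← <-elim p
    return (inj₂ (z , trans (sym e) (+-identityˡ _)))

  +-monoˡ-< : ∀ {x y} z → x <ᴹ y → x + z <ᴹ y + z
  +-monoˡ-< z p = pa Defs.<-+ origin _ _ z p

  +-monoʳ-< : ∀ {x y} z → x <ᴹ y → z + x <ᴹ z + y
  +-monoʳ-< z p = <-resp (+-comm _ z) (+-comm _ z) (+-monoˡ-< z p)

  -- The pairing relation only determines the double of the code; this turns bounds on the double
  -- into bounds on the code.
  double-cancel : ∀ {x y z} → x + x ≈ y + y + z → y ≤ x
  double-cancel {x} {y} {z} e = do
    inj₂ p ← ≤-or-> y x
      where inj₁ q → q
    λ _ → irrefl e (<-≤-trans (<-trans (+-monoˡ-< x p) (+-monoʳ-< y p)) x≤x+y)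

  div-unique : ∀ {m q q' v v'} → v <ᴹ m → v' <ᴹ m → q * m + v ≈ q' * m + v' → K (q ≈ q' × v ≈ v')
  div-unique {m} {q} {q'} {v} {v'} p p' e = trichotomy q q' >>= λ
    { (inj₁ h)        → λ _ → absurd p e h
    ; (inj₂ (inj₁ h)) → return (h , +-cancelˡ (q' * m) (trans (+-congʳ (*-congʳ (sym h))) e))
    ; (inj₂ (inj₂ h)) → λ _ → absurd p' (sym e) h }
    where
    absurd : ∀ {q q' v v'} → v <ᴹ m → q * m + v ≈ q' * m + v' → q <ᴹ q' → R
    absurd {q} {q'} {v} {v'} p e h = <-elim h λ { (z , f) → irrefl
      (+-cancelˡ (q * m) (begin
        q * m + v                    ≈⟨ e ⟩
        q' * m + v'                  ≈⟨ +-congʳ (*-congʳ f) ⟨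
        (q + (z + 1#)) * m + v'      ≈⟨ solve 4 (λ q z m v → (q :+ (z :+ con 1)) :* m :+ v
                := q :* m :+ (m :+ (z :* m :+ v))) refl q z m v' ⟩
        q * m + (m + (z * m + v'))   ∎))
      (<-≤-trans p x≤x+y) }

  induction : ∀ N {p : T (isΣ₁ N)} ρ → ⟦ N ⟧⁺ (0# ◂ ρ) →
    (∀ x → ⟦ N ⟧⁺ (x ◂ ρ) → ⟦ N ⟧⁺ (x + 1# ◂ ρ)) → ∀ x → ⟦ N ⟧⁺ (x ◂ ρ)
  induction N {p} ρ h₀ step x = from N (x ◂ ρ)
    (sound (iΣ₁ (ind (toΣ₁ N p))) ρ
      (⟦⟧-sub← ⌜ N ⌝ (σ₀ `0) (λ { zero → ≡.refl ; (suc _) → ≡.refl }) (to N (0# ◂ ρ) h₀))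
      (λ y h → ⟦⟧-sub← ⌜ N ⌝ (σ₀' (var zero `+ `1)) (λ { zero → ≡.refl ; (suc _) → ≡.refl })
        (to N (y + 1# ◂ ρ) (step y (from N (y ◂ ρ) h))))
      x)

  open Encoding semantic public

  -- The axiom `P` in the readable semantics, with the length that `ApproxB` quantifies over
  -- instantiated by z.
  monotone-approximation : ∀ N {p : T (isΣ₁ N)} ρ →
    (∀ x y y' → ⟦ N ⟧⁺ (y ◂ x ◂ ρ) → ⟦ N ⟧⁺ (y' ◂ x ◂ ρ) → y ≈ y') → ∀ z →
    K (Σ D λ s → Lth s z × (∀ i {u v x y} → i + 1# <ᴹ z → Ent s i u → Ent s (i + 1#) v →
                              x ≤ u → ⟦ N ⟧⁺ (y ◂ x ◂ ρ) → y ≤ v))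
  monotone-approximation N {p} ρ fun z = do
    s , h ← λ k → sound (pΣ₁ (toΣ₁ N p)) ρ
      (λ x y y' h → ≈-stable λ k → h λ a b → k (fun x y y' (plugged₁ a) (plugged₂ b))) z
              (λ s h → k (s , h))
    approx , lth ← λ k → h λ a b → k (a , b)
    let lth' = from (Encodingᶠ.Lth (lvl 1) (lvl 0) 2) (s ◂ z ◂ ρ) lth
    return (s , lth' , λ i {u} {v} {x} {y} i< e e' x≤u φ → do
      inj₁ y<v ← or-K (approx i z u v
          (λ k → k (to (Encodingᶠ.Lth (lvl 1) (lvl 3) 6) (v ◂ u ◂ z ◂ i ◂ s ◂ z ◂ ρ) lth')
            λ k → k i< λ k → k (to (Encodingᶠ.Ent (lvl 1) (lvl 2) (lvl 4) 6)
              (v ◂ u ◂ z ◂ i ◂ s ◂ z ◂ ρ) e)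
              (to (Encodingᶠ.Ent (lvl 1) (lvl 2 +B 1B) (lvl 5) 6) (v ◂ u ◂ z ◂ i ◂ s ◂ z ◂ ρ) e'))
          x y λ k → k (λ ¬< → ≈-stable λ k → ≤⇒≼ x≤u ¬< k) (plug φ))
        where inj₂ e → ≤-reflexive e
      <⇒≤ y<v)
    where
    ≤⇒≼ : ∀ {x y} → x ≤ y → (x <ᴹ y → R) → K (x ≈ y)
    ≤⇒≼ p ¬< = <+1-cases (≤⇒<+1 p) >>= λ { (inj₁ q) → λ _ → ¬< q ; (inj₂ q) → return q }
    plugged₁ : ∀ {x y y'} → ⟦ plug2 ⌜ N ⌝ (lvl 0) (lvl 1) 3 ⟧ (y' ◂ y ◂ x ◂ ρ) → ⟦ N ⟧⁺ (y ◂ x ◂ ρ)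
    plugged₁ h = from N _ (⟦⟧-sub→ ⌜ N ⌝ _
      -- `plug2` names the k-th parameter as variable k + 3, while the extended environment computes
      -- on 3 + k.
      (λ { zero → ≡.refl ; (suc zero) → ≡.refl ; (suc (suc k)) →
          ≡.cong (_ ◂ _ ◂ _ ◂ ρ) (ℕ.+-comm k 3) }) h)
    plugged₂ : ∀ {x y y'} → ⟦ plug2 ⌜ N ⌝ (lvl 0) (lvl 2) 3 ⟧ (y' ◂ y ◂ x ◂ ρ) → ⟦ N ⟧⁺ (y' ◂ x ◂ ρ)
    plugged₂ h = from N _ (⟦⟧-sub→ ⌜ N ⌝ _
      (λ { zero → ≡.refl ; (suc zero) → ≡.refl ; (suc (suc k)) →
          ≡.cong (_ ◂ _ ◂ _ ◂ ρ) (ℕ.+-comm k 3) }) h)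
    plug : ∀ {x y v u l i s z} → ⟦ N ⟧⁺ (y ◂ x ◂ ρ) →
      ⟦ plug2 ⌜ N ⌝ (lvl 6) (lvl 7) 8 ⟧ (y ◂ x ◂ v ◂ u ◂ l ◂ i ◂ s ◂ z ◂ ρ)
    plug h = ⟦⟧-sub← ⌜ N ⌝ _
      (λ { zero → ≡.refl ; (suc zero) → ≡.refl ; (suc (suc k)) → ≡.cong
              (_ ◂ _ ◂ _ ◂ _ ◂ _ ◂ _ ◂ _ ◂ _ ◂ ρ) (ℕ.+-comm k 8) }) (to N _ h)

-- Gödel's β-lemma

module Beta {ℓ} (L : Logic ℓ) where
  open Logic L

  modulus : Tm → Tm → Tm
  modulus b i = 𝟙 ⊕ (i ⊕ 𝟙) ⊗ b

  -- The entry relation with the components of the code kept apart; they are packed into a single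
  -- number only at the very end.
  Rem : Tm → Tm → Tm → Tm → Fm
  Rem A b i v = (v ⋖ modulus b i) ∧∧ (E< (A ⊕ 𝟙) λ q → A ≗ (q ⊗ modulus b i ⊕ v))

  Factor : Tm → Tm → Fm
  Factor b i = E< (b ⊕ 𝟙) λ e → b ≗ ((i ⊕ 𝟙) ⊗ e)

  CommonMultiple : Tm → Tm → Fm
  CommonMultiple k b = A< k λ i → Factor b i

  -- Stands in for the factorial in Gödel's lemma: divisibility by 1, ..., k makes the moduli
  -- pairwise coprime, and b > n leaves room for entries up to n.
  BigCommonMultiple : Tm → Tm → Fm
  BigCommonMultiple n k = E∃ λ b → (n ⋖ b) ∧∧ CommonMultiple k b

  Divisible : Tm → Tm → Tm → Fm
  Divisible b i c = E< (c ⊕ 𝟙) λ q → c ≗ (q ⊗ modulus b i)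

  -- The guard i ≤ k stands inside the quantifiers to make the formula Σ₁.
  CoprimeMultiple : Tm → Tm → Tm → Fm
  CoprimeMultiple b k i = E∃ λ c → E∃ λ x → E∃ λ y → (i ⋖ (k ⊕ 𝟙)) ⊃
    (A< i λ j → Divisible b j c) ∧∧ (x ⊗ c) ≗ (y ⊗ modulus b k ⊕ 𝟙)

  -- The bound on v keeps the formula Δ₀; in use, b' exceeds every entry of the source.
  Copies : Tm → Tm → Tm → Tm → Tm → Tm → Fm
  Copies A b A' b' o j = A< b' λ v → Rem A b j v ⊃ Rem A' b' (o ⊕ j) v

  Preserves : Tm → Tm → Tm → Tm → Fm
  Preserves A A' b i = A< b λ v → Rem A b i v ⊃ Rem A' b i v

  Copy : Tm → Tm → Tm → Tm → Tm → Tm → Tm → Fm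
  Copy A b l A₀ b' o k = E∃ λ A' → (k ⋖ (l ⊕ 𝟙)) ⊃
    (A< o λ i → Preserves A₀ A' b' i) ∧∧ (A< k λ j → Copies A b A' b' o j)

module Betaᶠ = Beta syntactic

module Sequences (M : Structure) (isM : IsModel PΣ₁ M) where

  open Arithmetic M isM public
  open Beta semantic public

  -- Stated for a formula and not for a mere predicate: the case x ≈ k needs replacement, and the
  -- case distinction needs stability.
  all<-suc : ∀ N ρ {k} → (∀ x → x <ᴹ k → ⟦ N ⟧⁺ (x ◂ ρ)) → ⟦ N ⟧⁺ (k ◂ ρ) →
    ∀ x → x <ᴹ k + 1# → ⟦ N ⟧⁺ (x ◂ ρ)
  all<-suc N ρ h hk x p = stable N (x ◂ ρ) (<+1-cases p >>= λ
    { (inj₁ q) → return (h x q) ; (inj₂ e) → return (replace N ρ (sym e) hk) })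

  ≤-multiple : ∀ {x} b i → x ≤ x * modulus b i
  ≤-multiple {x} b i = wit (x * ((i + 1#) * b))
    (solve 2 (λ x p → x :+ x :* p := x :* (con 1 :+ p)) refl x ((i + 1#) * b))

  Rem-intro : ∀ {A b i v} q → v <ᴹ modulus b i → A ≈ q * modulus b i + v → Rem A b i v
  Rem-intro {A} {b} {i} q p e = p ,
    return (q , ≤⇒<+1 (≤-trans (≤-trans (≤-multiple b i) x≤x+y) (≤-reflexive (sym e))) , e)

  Rem-≤ : ∀ {A b i v} → Rem A b i v → v ≤ A
  Rem-≤ (_ , h) = do
    q , _ , e ← h
    ≤-trans y≤x+y (≤-reflexive (sym e))

  Rem-unique : ∀ {A b i v v'} → Rem A b i v → Rem A b i v' → v ≈ v'
  Rem-unique (p , h) (p' , h') = ≈-stable do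
    q , _ , e ← h
    q' , _ , e' ← h'
    _ , f ← div-unique p p' (trans (sym e) e')
    return f

  big-common-multiple : ∀ n k → BigCommonMultiple n k
  big-common-multiple n = induction (Betaᶠ.BigCommonMultiple (free 1) (free 0) 0) (n ◂ origin)
    (return (n + 1# , <+1 , λ i p → λ _ → ≮0 p))
    λ k h → do
      b , n<b , cm ← h
      let b' = b * (k + 1#)
          b≤b' : b ≤ b'
          b≤b' = wit (b * k) (solve 2 (λ b k → b :+ b :* k := b :* (k :+ con 1)) refl b k)
      return (b' , <-≤-trans n<b b≤b' ,
        all<-suc (Betaᶠ.Factor (free 1) (free 0) 0) (b' ◂ origin)
          (λ i p → do
            e , _ , f ← cm i p
            let g : b' ≈ (i + 1#) * (e * (k + 1#))
                g = trans (*-congʳ f) (*-assoc (i + 1#) e (k + 1#))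
            return (e * (k + 1#) , ≤⇒<+1 (factor-≤ i g) , g))
          (return (b , ≤⇒<+1 b≤b' , *-comm b (k + 1#))))
    where
    factor-≤ : ∀ {b e} i → b ≈ (i + 1#) * e → e ≤ b
    factor-≤ {b} {e} i f = wit (i * e)
      (trans (solve 2 (λ i e → e :+ i :* e := (i :+ con 1) :* e) refl i e) (sym f))

  module _ {b L} (0<b : 0# <ᴹ b) (cm : CommonMultiple L b) where

    private
      m : D → D
      m = modulus b

    -- With w = (k+1)b ≡ -1 modulo m k, and b = (k-i)e, one has
    -- e(k+1) m i = b + e(i+1) m k, hence (k+1)w · e(k+1) m i ≡ w² ≡ 1.
    moduli-coprime : ∀ {i k} → k <ᴹ L → i <ᴹ k → K (Σ D λ x → Σ D λ y → x * m i ≈ y * m k + 1#)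
    moduli-coprime {i} {k} k<L i<k = do
      d , i+d≈k ← <-elim i<k
      let d<L : d <ᴹ L
          d<L = <-trans (<-≤-trans <+1 (≤-trans y≤x+y (≤-reflexive i+d≈k))) k<L
      e , _ , b≈de ← cm d d<L
      inj₂ (b' , b≈b'+1) ← 0-or-suc b
        where inj₁ b≈0 → λ _ → irrefl (sym b≈0) 0<b
      let w  = (k + 1#) * b
          w' = k * b + b'
          w≈w'+1 : w ≈ w' + 1#
          w≈w'+1 = begin
            (k + 1#) * b       ≈⟨ solve 2 (λ k b → (k :+ con 1) :* b := k :* b :+ b) refl k b ⟩
            k * b + b          ≈⟨ +-congˡ b≈b'+1 ⟩
            k * b + (b' + 1#)  ≈⟨ +-assoc (k * b) b' 1# ⟨
            w' + 1#            ∎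
          step : (e * (k + 1#)) * m i ≈ b + (e * (i + 1#)) * m k
          step = begin
            (e * (k + 1#)) * m i
              ≈⟨ *-congʳ (*-congˡ (+-congʳ i+d≈k)) ⟨
            (e * (i + (d + 1#) + 1#)) * m i
              ≈⟨ solve 4 (λ e i d b → (e :* (i :+ (d :+ con 1) :+ con 1)) :* (con 1 :+ (i :+ con 1) :* b)
                   := (d :+ con 1) :* e :+ (e :* (i :+ con 1)) :*
                           (con 1 :+ (i :+ (d :+ con 1) :+ con 1) :* b)) refl e i d b ⟩
            (d + 1#) * e + (e * (i + 1#)) * m (i + (d + 1#))
              ≈⟨ +-cong (sym b≈de) (*-congˡ (+-congˡ (*-congʳ (+-congʳ i+d≈k)))) ⟩
            b + (e * (i + 1#)) * m k  ∎
          z  = (k + 1#) * w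
          y  = w' + z * (e * (i + 1#))
      return (z * (e * (k + 1#)) , y , (begin
        z * (e * (k + 1#)) * m i             ≈⟨ *-assoc z _ _ ⟩
        z * (e * (k + 1#) * m i)             ≈⟨ *-congˡ step ⟩
        z * (b + (e * (i + 1#)) * m k)
          ≈⟨ solve 5 (λ k w b f n → (k :* w) :* (b :+ f :* n)
                  := w :* (k :* b) :+ k :* w :* f :* n) refl (k + 1#) w b (e * (i + 1#)) (m k) ⟩
        w * w + z * (e * (i + 1#)) * m k      ≈⟨ +-congʳ (*-congʳ w≈w'+1) ⟩
        (w' + 1#) * w + z * (e * (i + 1#)) * m k
          ≈⟨ +-congʳ (trans (solve 2 (λ v w → (v :+ con 1) :* w
                  := v :* w :+ w) refl w' w) (+-congˡ w≈w'+1)) ⟩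
        w' * w + (w' + 1#) + z * (e * (i + 1#)) * m k
          ≈⟨ solve 3 (λ v w u → v :* w :+ (v :+ con 1) :+ u :* (con 1 :+ w)
                  := (v :+ u) :* (con 1 :+ w) :+ con 1) refl w' w (z * (e * (i + 1#))) ⟩
        y * m k + 1#                          ∎))

    -- In effect c is the product of the first i moduli, built up without coding a product. The
    -- inverse of c modulo `m k` is carried along, and inverses multiply.
    coprime-multiple : ∀ {k} → k <ᴹ L → ∀ i → CoprimeMultiple b k i
    coprime-multiple {k} k<L = induction (Betaᶠ.CoprimeMultiple (free 1) (free 2) (free 0) 0)
            (b ◂ k ◂ origin)
      (return (1# , return (1# , return (0# , λ _ → (λ _ p _ → ≮0 p) ,
        solve 1 (λ n → con 1 :* con 1 := con 0 :* n :+ con 1) refl (m k)))))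
      λ i h → do
        inj₁ i+1<k+1 ← lem (i + 1# <ᴹ k + 1#)
          where inj₂ ¬h → return (0# , return
                  (0# , return (0# , λ p → (λ _ _ _ → ¬h p) , ≈-stable λ _ → ¬h p)))
        c , h ← h
        x , h ← h
        y , h ← h
        let i<k = <-≤-trans <+1 (<+1⇒≤ i+1<k+1)
            div , e = h (<-trans i<k <+1)
        x₀ , y₀ , e₀ ← moduli-coprime k<L i<k
        return (c * m i , return (x * x₀ , return (y * m k * y₀ + y + y₀ , λ _ →
          all<-suc (Betaᶠ.Divisible (free 1) (free 0) (free 2) 0) (b ◂ c * m i ◂ origin)
            (λ j j<i → do
              q , _ , f ← div j j<i
              let g : c * m i ≈ (q * m i) * m j
                  g = trans (*-congʳ f) (solve 3 (λ q x y → q :* x :* y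
                          := q :* y :* x) refl q (m j) (m i))
              return (q * m i , ≤⇒<+1 (≤-trans (≤-multiple b j) (≤-reflexive (sym g))) , g))
            (return (c , ≤⇒<+1 (≤-multiple b i) , refl))
          , (begin
            (x * x₀) * (c * m i)    ≈⟨ solve 4 (λ x u c v → x :* u :* (c :* v)
                    := (x :* c) :* (u :* v)) refl x x₀ c (m i) ⟩
            (x * c) * (x₀ * m i)    ≈⟨ *-cong e e₀ ⟩
            (y * m k + 1#) * (y₀ * m k + 1#)
              ≈⟨ solve 3 (λ y n z → (y :* n :+ con 1) :* (z :* n :+ con 1)
                      := (y :* n :* z :+ y :+ z) :* n :+ con 1) refl y (m k) y₀ ⟩
            (y * m k * y₀ + y + y₀) * m k + 1#  ∎))))

    -- m k divides w + 1 for w = (k+1)b, so adding c x (v + A w), which is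
    -- v + A w modulo m k, turns A into a number congruent to v.
    set-entry : ∀ {k v} A → k <ᴹ L → v <ᴹ b →
      K (Σ D λ A' → Rem A' b k v × (∀ i → i <ᴹ k → ∀ u → Rem A b i u → Rem A' b i u))
    set-entry {k} {v} A k<L v<b = do
      c , h ← coprime-multiple k<L k
      x , h ← h
      y , h ← h
      let div , e = h <+1
          w = (k + 1#) * b
          s = v + A * w
      return (A + c * (x * s)
        , Rem-intro (A + y * s) (<-≤-trans v<b
                (wit (1# + k * b) (solve 2 (λ k b → b :+ (con 1 :+ k :* b)
                        := con 1 :+ (k :+ con 1) :* b) refl k b)))
            (begin
              A + c * (x * s)          ≈⟨ solve 4 (λ a c x s → a :+ c :* (x :* s)
                      := a :+ (x :* c) :* s) refl A c x s ⟩
              A + (x * c) * s          ≈⟨ +-congˡ (*-congʳ e) ⟩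
              A + (y * m k + 1#) * s   ≈⟨ solve 4
                      (λ a w v y → a :+ (y :* (con 1 :+ w) :+ con 1) :* (v :+ a :* w)
                                              := (a :+ y :* (v :+ a :* w)) :* (con 1 :+ w) :+ v) refl A
                                                      w v y ⟩
              (A + y * s) * m k + v    ∎)
        , λ i i<k u r → proj₁ r , λ kk → (do
            q , _ , f ← proj₂ r
            q' , _ , g ← div i i<k
            return (Rem-intro (q + q' * (x * s)) (proj₁ r) (begin
              A + c * (x * s)                       ≈⟨ +-cong f (*-congʳ g) ⟩
              q * m i + u + (q' * m i) * (x * s)
                      ≈⟨ solve 5 (λ q n u p t → q :* n :+ u :+ (p :* n) :* t
                              := (q :+ p :* t) :* n :+ u) refl q (m i) u q' (x * s) ⟩
              (q + q' * (x * s)) * m i + u          ∎))) λ z → proj₂ z kk)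

    -- Chinese remaindering one entry at a time. The order is forced: `set-entry` protects only the
    -- positions before the one it sets.
    copy : ∀ A b₁ l A₀ o → (∀ k → k <ᴹ l → o + k <ᴹ L) → ∀ k → Copy A b₁ l A₀ b o k
    copy A b₁ l A₀ o inL = induction
            (Betaᶠ.Copy (free 1) (free 2) (free 3) (free 4) (free 5) (free 6) (free 0) 0)
      (A ◂ b₁ ◂ l ◂ A₀ ◂ b ◂ o ◂ origin)
      (return (A₀ , λ _ → (λ i _ v _ r → r) , (λ j p → λ v _ _ → <-stable (λ _ → ≮0 p) , λ _ → ≮0 p)))
      λ k h → do
        inj₁ k+1<l+1 ← lem (k + 1# <ᴹ l + 1#)
          where inj₂ ¬h → return (0# , λ p → (λ i _ v _ _ → <-stable (λ _ → ¬h p) , λ _ → ¬h p)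
                                           , (λ i _ v _ _ → <-stable (λ _ → ¬h p) , λ _ → ¬h p))
        A' , h ← h
        let k<l = <-≤-trans <+1 (<+1⇒≤ k+1<l+1)
            pres , cop = h (<-trans k<l <+1)
            copied : Formula⁺
            copied = Betaᶠ.Copies (free 1) (free 2) (free 3) (free 4) (free 5) (free 0) 0
        inj₁ (v , v<b , r) ← lem (Σ D λ v → v <ᴹ b × Rem A b₁ k v)
          where inj₂ ¬h → return (A' , λ _ → pres , all<-suc copied (A ◂ b₁ ◂ A' ◂ b ◂ o ◂ origin) cop
                            λ v v<b r → <-stable (λ _ → ¬h (v , v<b , r)) , λ _ → ¬h (v , v<b , r))
        A'' , new , old ← set-entry {o + k} A' (inL k k<l) v<b
        return (A'' , λ _ →
          (λ i i<o u u<b r → old i (<-≤-trans i<o x≤x+y) u (pres i i<o u u<b r))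
          , all<-suc copied (A ◂ b₁ ◂ A'' ◂ b ◂ o ◂ origin)
              (λ j j<k u u<b r → old (o + j) (+-monoʳ-< o j<k) u (cop j j<k u u<b r))
              λ u u<b r' → replace (Betaᶠ.Rem (free 1) (free 2) (free 3) (free 0) 0)
                      (A'' ◂ b ◂ o + k ◂ origin)
                (Rem-unique r r') new)

  -- Joining two coded sequences

  Embeds : D → D → D → D → D → D → Set
  Embeds A b l A' b' o = ∀ j → j <ᴹ l → ∀ v → Rem A b j v → Rem A' b' (o + j) v

  concatenate : ∀ A₁ b₁ l₁ A₂ b₂ l₂ t → K (Σ D λ A → Σ D λ b →
    Embeds A₁ b₁ l₁ A b 0# × Embeds A₂ b₂ l₂ A b l₁ × Rem A b (l₁ + l₂) t)
  concatenate A₁ b₁ l₁ A₂ b₂ l₂ t = do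
    -- Entries are remainders of A₁ or A₂, so n bounds them all, and t as well. The additional
    -- modulus in L is for t.
    let n = A₁ + A₂ + t
        L = l₁ + l₂ + 1#
    b , n<b , cm ← big-common-multiple n L
    let 0<b = ≤-<-trans 0≤ n<b
        A₁≤n = ≤-trans x≤x+y x≤x+y
        A₂≤n = ≤-trans y≤x+y x≤x+y
    A , h ← copy 0<b cm A₁ b₁ l₁ 0# 0#
            (λ k p → <-resp (sym (+-identityˡ k)) refl (<-≤-trans p (≤-trans x≤x+y x≤x+y))) l₁
    let _ , first = h <+1
    A' , h ← copy 0<b cm A₂ b₂ l₂ A l₁ (λ k p → <-≤-trans (+-monoʳ-< l₁ p) x≤x+y) l₂
    let pres , second = h <+1
    A'' , new , old ← set-entry 0<b cm {l₁ + l₂} {t} A' <+1 (≤-<-trans y≤x+y n<b)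
    return (A'' , b
      , (λ j p v r → let p' = <-resp (sym (+-identityˡ j)) refl p
                         v<b = ≤-<-trans (≤-trans (Rem-≤ r) A₁≤n) n<b
                     in old (0# + j) (<-≤-trans p' x≤x+y) v (pres (0# + j) p' v v<b (first j p v v<b r)))
      , (λ j p v r → let v<b = ≤-<-trans (≤-trans (Rem-≤ r) A₂≤n) n<b
                     in old (l₁ + j) (+-monoʳ-< l₁ p) v (second j p v v<b r))
      , new)

-- Computations of the Ackermann function

module Trace {ℓ} (L : Logic ℓ) where
  open Logic L
  open Encoding L using (Trip; Ent)
  open Beta L using (Rem)

  Even : Tm → Fm
  Even n = E∃ λ c → (c ⊕ c) ≗ n ⊗ (n ⊕ 𝟙)

  Quotient : Tm → Tm → Fm
  Quotient m a = E∃ λ q → E∃ λ r → (r ⋖ m) ∧∧ (a ≗ (q ⊗ m ⊕ r))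

  Unpaired : Tm → Fm
  Unpaired c = E∃ λ a → E∃ λ b → Encoding.Pair L a b c

  Entry : Tm → Tm → Tm → Tm → Tm → Tm → Fm
  Entry A b j α n k = E< (A ⊕ 𝟙) λ t → Rem A b j t ∧∧ Trip α n k t

  Has : Tm → Tm → Tm → Tm → Tm → Tm → Fm
  Has A b l α n k = E< l λ j → Entry A b j α n k

  -- In the equation A(α'+1,n) = A(α',r), the argument r is 1 if n = 0 and
  -- A(α'+1,n-1) otherwise.
  Next : Tm → Tm → Tm → Tm → Tm → Tm → Fm
  Next A b l α n r =
    ((n ≗ 𝟘) ∧∧ (r ≗ 𝟙)) ∨∨ (E< (n ⊕ 𝟙) λ n' → (n ≗ (n' ⊕ 𝟙)) ∧∧ Has A b l α n' r)

  Justified : Tm → Tm → Tm → Tm → Tm → Tm → Fm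
  Justified A b j α n k =
    ((α ≗ 𝟘) ∧∧ (k ≗ (n ⊕ 𝟙))) ∨∨
    (E< (α ⊕ 𝟙) λ α' → (α ≗ (α' ⊕ 𝟙)) ∧∧
      (E< (A ⊕ 𝟙) λ r → Next A b j α n r ∧∧ Has A b j α' r k))

  Good : Tm → Tm → Tm → Fm
  Good A b j = E< (A ⊕ 𝟙) λ α → E< (A ⊕ 𝟙) λ n → E< (A ⊕ 𝟙) λ k →
    Entry A b j α n k ∧∧ Justified A b j α n k

  Comp : Tm → Tm → Tm → Fm
  Comp A b l = A< l λ j → Good A b j

  Filled : Tm → Tm → Tm → Tm → Tm → Fm
  Filled A b l α n = E< (A ⊕ 𝟙) λ k → Has A b l α n k

  Row : Tm → Tm → Tm → Tm → Tm → Fm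
  Row A b l α n = A< n λ x → Filled A b l α x

  RowTrace : Tm → Tm → Tm → Fm
  RowTrace α N n = E∃ λ A → E∃ λ b → E∃ λ l → (n ⋖ (N ⊕ 𝟙)) ⊃ Comp A b l ∧∧ Row A b l α n

  -- An argument pair (α,n) with α ≤ m is coded by x = n(m+1) + α.
  Bound : Tm → Tm → Tm → Tm → Fm
  Bound m n₀ x y =
    E< (y ⊕ 𝟙) λ A → E< (y ⊕ 𝟙) λ b → E< (y ⊕ 𝟙) λ l →
    E< (m ⊕ 𝟙) λ α → E< (x ⊕ 𝟙) λ n → E< (y ⊕ 𝟙) λ r →
      (x ≗ (n ⊗ (m ⊕ 𝟙) ⊕ α)) ∧∧ Comp A b l ∧∧ Row A b l α n ∧∧ Next A b l α n r ∧∧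
      ((r ⊕ 𝟙) ⊗ (m ⊕ 𝟙) ⋖ (y ⊕ 𝟙)) ∧∧ ((n₀ ⊕ 𝟙) ⊗ (m ⊕ 𝟙) ⋖ (y ⊕ 𝟙))

  NoBoundBelow : Tm → Tm → Tm → Tm → Fm
  NoBoundBelow m n₀ x z = A< z λ y → Bound m n₀ x y ⊃ ff

  LeastBound : Tm → Tm → Tm → Tm → Fm
  LeastBound m n₀ x y = Bound m n₀ x y ∧∧ NoBoundBelow m n₀ x y

  -- The upper half of N being the quotient of u is recorded here for the next level; `row-suc`
  -- receives the lower half directly.
  Stage : Tm → Tm → Tm → Fm
  Stage s m a = E∃ λ i → E∃ λ u → E∃ λ N → E∃ λ A → E∃ λ b → E∃ λ l → (a ⋖ (m ⊕ 𝟙)) ⊃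
    ((i ⊕ a) ≗ (m ⊕ 𝟙)) ∧∧ Ent s i u ∧∧ (u ⋖ (N ⊕ 𝟙) ⊗ (m ⊕ 𝟙)) ∧∧ Comp A b l ∧∧ Row A b l a N

module Traceᶠ = Trace syntactic

module Computations (M : Structure) (isM : IsModel PΣ₁ M) where

  open Sequences M isM public
  open Trace semantic public

  -- Pairing and division in the model

  +-cancel-< : ∀ x {y z} → x + y <ᴹ x + z → y <ᴹ z
  +-cancel-< x {y} {z} p = <-stable do
    inj₁ z≤y ← ≤-or-> z y
      where inj₂ q → return q
    d , e ← z≤y
    λ _ → irrefl refl (<-≤-trans p (wit d (trans (+-assoc x z d) (+-congˡ e))))

  ≤*suc : ∀ {x m} → x ≤ x * (m + 1#)
  ≤*suc {x} {m} = wit (x * m) (solve 2 (λ x m → x :+ x :* m := x :* (m :+ con 1)) refl x m)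

  even : ∀ n → Even n
  even = induction (Traceᶠ.Even (free 0) 0) origin
    (return (0# , solve 0 (con 0 :+ con 0 := con 0 :* (con 0 :+ con 1)) refl))
    λ n h → do
      c , e ← h
      return (c + (n + 1#) , (begin
        (c + (n + 1#)) + (c + (n + 1#))   ≈⟨ solve 2 (λ c n → (c :+ n) :+ (c :+ n)
                := (c :+ c) :+ (n :+ n)) refl c (n + 1#) ⟩
        (c + c) + ((n + 1#) + (n + 1#))   ≈⟨ +-congʳ e ⟩
        n * (n + 1#) + ((n + 1#) + (n + 1#))
                ≈⟨ solve 1 (λ n → n :* (n :+ con 1) :+ ((n :+ con 1) :+ (n :+ con 1))
                        := (n :+ con 1) :* (n :+ con 1 :+ con 1)) refl n ⟩
        (n + 1#) * (n + 1# + 1#)          ∎))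

  pair : ∀ a b → K (Σ D (Pair a b))
  pair a b = do
    c , e ← even (a + b)
    return (c + b , trans (solve 2 (λ c b → (c :+ b) :+ (c :+ b)
            := (c :+ c) :+ (b :+ b)) refl c b) (+-congʳ e))

  -- Subtracting 2a from the pairing polynomial leaves a negative coefficient. After splitting off a
  -- = 0, substituting a'+1 for a makes all coefficients positive.
  Pair-≤ˡ : ∀ {a b c} → Pair a b c → a ≤ c
  Pair-≤ˡ {a} {b} {c} e = do
    inj₂ (a' , f) ← 0-or-suc a
      where inj₁ f → ≤-trans (≤-reflexive f) 0≤
    double-cancel {z = a' * (a' + 1#) + b * (a' + a' + b + 1# + 1# + 1#) + (b + b)} (begin
      c + c                                     ≈⟨ e ⟩
      (a + b) * (a + b + 1#) + (b + b)          ≈⟨ +-congʳ (*-cong (+-congʳ f) (+-congʳ (+-congʳ f))) ⟩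
      ((a' + 1#) + b) * ((a' + 1#) + b + 1#) + (b + b)
        ≈⟨ solve 2 (λ a b → ((a :+ con 1) :+ b) :* ((a :+ con 1) :+ b :+ con 1) :+ (b :+ b)
             := (a :+ con 1) :+ (a :+ con 1) :+
                     (a :* (a :+ con 1) :+ b :* (a :+ a :+ b :+ con 1 :+ con 1 :+ con 1) :+ (b :+ b)))
                             refl a' b ⟩
      (a' + 1#) + (a' + 1#) + _                 ≈⟨ +-congʳ (+-cong f f) ⟨
      a + a + _                                 ∎)

  Pair-≤ʳ : ∀ {a b c} → Pair a b c → b ≤ c
  Pair-≤ʳ {a} {b} e = double-cancel (trans e (+-comm _ (b + b)))

  -- Again the walk along antidiagonals: the successor of (a'+1, b) is (a', b+1), that of (0, b) is
  -- (b+1, 0).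
  unpaired : ∀ c → Unpaired c
  unpaired = induction (Traceᶠ.Unpaired (free 0) 0) origin
    (return (0# , return (0# , solve 0 (con 0 :+ con 0
            := (con 0 :+ con 0) :* (con 0 :+ con 0 :+ con 1) :+ (con 0 :+ con 0)) refl)))
    λ c h → do
      a , h ← h
      b , e ← h
      inj₂ (a' , f) ← 0-or-suc a
        where
        inj₁ f → return (b + 1# , return (0# , (begin
          c + 1# + (c + 1#)                ≈⟨ solve 1 (λ c → c :+ con 1 :+ (c :+ con 1)
                  := c :+ c :+ (con 1 :+ con 1)) refl c ⟩
          c + c + (1# + 1#)
                  ≈⟨ +-congʳ (trans e (+-congʳ (*-cong (+-congʳ f) (+-congʳ (+-congʳ f))))) ⟩
          (0# + b) * (0# + b + 1#) + (b + b) + (1# + 1#)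
            ≈⟨ solve 1 (λ b → (con 0 :+ b) :* (con 0 :+ b :+ con 1) :+ (b :+ b) :+ (con 1 :+ con 1)
                 := (b :+ con 1 :+ con 0) :* (b :+ con 1 :+ con 0 :+ con 1) :+ (con 0 :+ con 0)) refl b ⟩
          (b + 1# + 0#) * (b + 1# + 0# + 1#) + (0# + 0#)  ∎)))
      return (a' , return (b + 1# , (begin
        c + 1# + (c + 1#)                ≈⟨ solve 1 (λ c → c :+ con 1 :+ (c :+ con 1)
                := c :+ c :+ (con 1 :+ con 1)) refl c ⟩
        c + c + (1# + 1#)
                ≈⟨ +-congʳ (trans e (+-congʳ (*-cong (+-congʳ f) (+-congʳ (+-congʳ f))))) ⟩
        (a' + 1# + b) * (a' + 1# + b + 1#) + (b + b) + (1# + 1#)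
          ≈⟨ solve 2 (λ a b → (a :+ con 1 :+ b) :* (a :+ con 1 :+ b :+ con 1) :+ (b :+ b) :+
                  (con 1 :+ con 1)
               := (a :+ (b :+ con 1)) :* (a :+ (b :+ con 1) :+ con 1) :+ (b :+ con 1 :+ (b :+ con 1)))
                       refl a' b ⟩
        (a' + (b + 1#)) * (a' + (b + 1#) + 1#) + (b + 1# + (b + 1#))  ∎)))

  quotient : ∀ {m} → 0# <ᴹ m → ∀ a → Quotient m a
  quotient {m} 0<m = induction (Traceᶠ.Quotient (free 1) (free 0) 0) (m ◂ origin)
    (return (0# , return (0# , 0<m , solve 1 (λ m → con 0 := con 0 :* m :+ con 0) refl m)))
    λ a h → do
      q , h ← h
      r , r<m , e ← h
      z , f ← <-elim r<m
      inj₁ 0<z ← 0-or-pos z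
        where inj₂ 0≈z → return (q + 1# , return (0# , 0<m , (begin
                a + 1#                  ≈⟨ +-congʳ e ⟩
                q * m + r + 1#          ≈⟨ +-assoc (q * m) r 1# ⟩
                q * m + (r + 1#)        ≈⟨ +-congˡ
                        (+-congˡ (trans (sym (+-identityˡ 1#)) (+-congʳ 0≈z))) ⟩
                q * m + (r + (z + 1#))  ≈⟨ +-congˡ f ⟩
                q * m + m               ≈⟨ solve 2 (λ q m → q :* m :+ m
                        := (q :+ con 1) :* m :+ con 0) refl q m ⟩
                (q + 1#) * m + 0#       ∎)))
      return (q , return (r + 1# ,
        <-resp (+-comm 1# r) (trans (solve 2 (λ z r → z :+ con 1 :+ r := r :+ (z :+ con 1)) refl z r) f)
          (+-monoˡ-< r (<-resp (+-identityˡ 1#) refl (+-monoˡ-< 1# 0<z)))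
        , trans (+-congʳ e) (+-assoc (q * m) r 1#)))

  triple : ∀ a b c → K (Σ D (Trip a b c))
  triple a b c = do
    w , e ← pair b c
    t , f ← pair a w
    return (t , return (w , ≤⇒<+1 (Pair-≤ʳ f) , e , f))

  Trip-≤ : ∀ {a b c t} → Trip a b c t → a ≤ t × b ≤ t × c ≤ t
  Trip-≤ h = (h >>= λ { (w , _ , e , f) → Pair-≤ˡ f })
           , (h >>= λ { (w , _ , e , f) → ≤-trans (Pair-≤ˡ e) (Pair-≤ʳ f) })
           , (h >>= λ { (w , _ , e , f) → ≤-trans (Pair-≤ʳ e) (Pair-≤ʳ f) })

  Entry-≤ : ∀ {A b j α n k} → Entry A b j α n k → K (α ≤ A × n ≤ A × k ≤ A)
  Entry-≤ h = do
    t , t≤A , _ , e ← h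
    let p , q , r = Trip-≤ e
        le = <+1⇒≤ t≤A
    return (≤-trans p le , ≤-trans q le , ≤-trans r le)

  Has-≤ : ∀ {A b l α n k} → Has A b l α n k → K (α ≤ A × n ≤ A × k ≤ A)
  Has-≤ h = do
    j , _ , e ← h
    Entry-≤ e

  -- Forgets positions: containing an entry, and hence being a justification, survives any such
  -- relocation.
  record _↪_ (p p' : D × D × D) : Set where
    constructor embedding
    field
      move : ∀ j → j <ᴹ proj₂ (proj₂ p) → ∀ v → Rem (proj₁ p) (proj₁ (proj₂ p)) j v →
             K (Σ D λ j' → j' <ᴹ proj₂ (proj₂ p') × Rem (proj₁ p') (proj₁ (proj₂ p')) j' v)
  open _↪_

  Entry-map : ∀ {A b A' b' i j α n k} → (∀ v → Rem A b j v → Rem A' b' i v) →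
    Entry A b j α n k → Entry A' b' i α n k
  Entry-map f h = do
    t , _ , r , e ← h
    return (t , ≤⇒<+1 (Rem-≤ (f t r)) , f t r , e)

  Has-map : ∀ {A b l A' b' l' α n k} → (A , b , l) ↪ (A' , b' , l') → Has A b l α n k → Has A' b' l' α n k
  Has-map f h = do
    j , j<l , h ← h
    t , _ , r , e ← h
    j' , j'<l' , r' ← move f j j<l t r
    return (j' , j'<l' , return (t , ≤⇒<+1 (Rem-≤ r') , r' , e))

  Next-map : ∀ {A b l A' b' l' α n r} → (A , b , l) ↪ (A' , b' , l') →
    Next A b l α n r → Next A' b' l' α n r
  Next-map f h = h >>= λ
    { (inj₁ e) → return (inj₁ e)
    ; (inj₂ h) → return (inj₂ (h >>= λ { (n' , p , e , h) → return (n' , p , e , Has-map f h) })) }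

  justify : ∀ {A b j α n r k} → Next A b j (α + 1#) n r → Has A b j α r k → Justified A b j (α + 1#) n k
  justify {α = α} nx h = return (inj₂ (return (α , <-trans <+1 <+1 , refl , do
    _ , r≤A , _ ← Has-≤ h
    return (_ , ≤⇒<+1 r≤A , nx , h))))

  Justified-map : ∀ {A b l A' b' l' α n k} → (A , b , l) ↪ (A' , b' , l') →
    Justified A b l α n k → Justified A' b' l' α n k
  Justified-map f h = h >>= λ
    { (inj₁ e) → return (inj₁ e)
    ; (inj₂ h) → return (inj₂ do
        α' , p , e , h ← h
        return (α' , p , e , do
          r , _ , nx , h ← h
          _ , r≤A' , _ ← Has-≤ (Has-map f h)
          return (r , ≤⇒<+1 r≤A' , Next-map f nx , Has-map f h))) }

  Good-intro : ∀ {A b j α n k} → Entry A b j α n k → Justified A b j α n k → Good A b j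
  Good-intro e J = do
    p , q , r ← Entry-≤ e
    return (_ , ≤⇒<+1 p , return (_ , ≤⇒<+1 q , return (_ , ≤⇒<+1 r , e , J)))

  Good-map : ∀ {A b A' b' i j} → (∀ v → Rem A b j v → Rem A' b' i v) →
    (A , b , j) ↪ (A' , b' , i) → Good A b j → Good A' b' i
  Good-map f g h = do
    α , _ , h ← h
    n , _ , h ← h
    k , _ , e , J ← h
    Good-intro (Entry-map f e) (Justified-map g J)

  Embeds⇒↪ : ∀ {A b l A' b' l' o} → (∀ j → j <ᴹ l → o + j <ᴹ l') → Embeds A b l A' b' o →
    (A , b , l) ↪ (A' , b' , l')
  Embeds⇒↪ {o = o} o+j<l f = embedding λ j p v r → return (o + j , o+j<l j p , f j p v r)

  -- The code of the concatenation is only obtained inside, so the new last entry has to come with a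
  -- justification valid in every sequence containing both.
  merge : ∀ {A₁ b₁ l₁ A₂ b₂ l₂ α n k} → Comp A₁ b₁ l₁ → Comp A₂ b₂ l₂ →
    (∀ {A b l} → (A₁ , b₁ , l₁) ↪ (A , b , l) → (A₂ , b₂ , l₂) ↪ (A , b , l) → Justified A b l α n k) →
    K (Σ D λ A → Σ D λ b → Σ D λ l → Comp A b l ×
       (A₁ , b₁ , l₁) ↪ (A , b , l) × (A₂ , b₂ , l₂) ↪ (A , b , l) × Has A b l α n k)
  merge {A₁} {b₁} {l₁} {A₂} {b₂} {l₂} {α} {n} {k} c₁ c₂ J = do
    t , tr ← triple α n k
    A , b , e₁ , e₂ , r ← concatenate A₁ b₁ l₁ A₂ b₂ l₂ t
    let l = l₁ + l₂
        lt₁ : ∀ j → j <ᴹ l₁ → 0# + j <ᴹ l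
        lt₁ j p = <-≤-trans (<-resp (sym (+-identityˡ j)) refl p) x≤x+y
        lt₂ : ∀ j → j <ᴹ l₂ → l₁ + j <ᴹ l
        lt₂ j p = +-monoʳ-< l₁ p
        entry : Entry A b l α n k
        entry = return (t , ≤⇒<+1 (Rem-≤ r) , r , tr)
        at : ∀ {i j} → i ≈ j → Good A b i → Good A b j
        at = replace (Traceᶠ.Good (free 1) (free 2) (free 0) 0) (A ◂ b ◂ origin)
    return (A , b , l + 1#
      , (λ i p → stable (Traceᶠ.Good (free 1) (free 2) (free 0) 0) (i ◂ A ◂ b ◂ origin) do
          inj₁ l₁≤i ← ≤-or-> l₁ i
            where inj₂ i<l₁ → return (at (+-identityˡ i) (Good-map (e₁ i i<l₁)
                    (Embeds⇒↪ (λ j q → +-monoʳ-< 0# q) λ j q → e₁ j (<-trans q i<l₁)) (c₁ i i<l₁)))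
          j , e ← l₁≤i
          inj₁ j<l₂ ← <+1-cases (+-cancel-< l₁ (<-resp (sym e) (+-assoc l₁ l₂ 1#) p))
            where inj₂ j≈l₂ → return (at (trans (+-congˡ (sym j≈l₂)) e)
                    (Good-intro entry (J (Embeds⇒↪ lt₁ e₁) (Embeds⇒↪ lt₂ e₂))))
          return (at e (Good-map (e₂ j j<l₂)
            (Embeds⇒↪ (λ i q → +-monoʳ-< l₁ q) λ i q → e₂ i (<-trans q j<l₂)) (c₂ j j<l₂))))
      , Embeds⇒↪ (λ j p → <-trans (lt₁ j p) <+1) e₁
      , Embeds⇒↪ (λ j p → <-trans (lt₂ j p) <+1) e₂
      , return (l , <+1 , entry))

  HasRow : D → D → Set
  HasRow α n = K (Σ D λ A → Σ D λ b → Σ D λ l → Comp A b l × Row A b l α n)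

  extend-row : ∀ {A b l A' b' l' α n k} → (A , b , l) ↪ (A' , b' , l') → Row A b l α n →
    Has A' b' l' α n k → Row A' b' l' α (n + 1#)
  extend-row {A' = A'} {b'} {l'} {α} f row h =
    all<-suc (Traceᶠ.Filled (free 1) (free 2) (free 3) (free 4) (free 0) 0) (A' ◂ b' ◂ l' ◂ α ◂ origin)
      (λ x p → do
        k , _ , h ← row x p
        bounded (Has-map f h))
      (bounded h)
    where
    bounded : ∀ {x k} → Has A' b' l' α x k → Filled A' b' l' α x
    bounded h = do
      _ , _ , k≤A' ← Has-≤ h
      return (_ , ≤⇒<+1 k≤A' , h)

  -- A step may discard the given computation and return an unrelated one; `row-suc` depends on this
  -- freedom.
  row-induction : ∀ α N → (∀ {A b l n} → n <ᴹ N → Comp A b l → Row A b l α n → HasRow α (n + 1#)) →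
    HasRow α N
  row-induction α N step = do
    A , h ← all-rows N
    b , h ← h
    l , h ← h
    let c , row = h <+1
    return (A , b , l , c , row)
    where
    all-rows : ∀ n → RowTrace α N n
    all-rows = induction (Traceᶠ.RowTrace (free 1) (free 2) (free 0) 0) (α ◂ N ◂ origin)
      (return (0# , return (0# , return (0# , λ _ → (λ _ p _ → ≮0 p) , λ _ p _ → ≮0 p))))
      λ n h → do
        inj₁ p ← lem (n + 1# <ᴹ N + 1#)
          where inj₂ ¬h → return (0# , return
                  (0# , return (0# , λ p → (λ _ _ _ → ¬h p) , λ _ _ _ → ¬h p)))
        A , h ← h
        b , h ← h
        l , h ← h
        let n<N = <-≤-trans <+1 (<+1⇒≤ p)
            c , row = h (<-trans n<N <+1)
        A' , b' , l' , c' , row' ← step n<N c row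
        return (A' , return (b' , return (l' , λ _ → c' , row')))

  row-zero : ∀ N → HasRow 0# N
  row-zero N = row-induction 0# N λ {_} {_} {_} {n} _ c row → do
    A , b , l , c' , f , _ , h ← merge {A₂ = 0#} {0#} {0#} {0#} {n} {n + 1#} c (λ _ p _ → ≮0 p) λ _ _ →
            return (inj₁ (refl , refl))
    return (A , b , l , c' , extend-row f row h)

-- Totality

module Totality (M : Structure) (isM : IsModel PΣ₁ M) where

  open Computations M isM public

  -- Every number is a pair and division by a modulus always succeeds, so entries exist at all
  -- indices, even past the length.
  entries : ∀ {s z} → Lth s z → ∀ i → K (Σ D λ u → Ent s i u)
  entries {s} {z} h i = do
    w , w≤s , e ← h
    A , h ← unpaired w
    b , f ← h
    q , h ← quotient (<-resp refl (+-comm _ 1#) (0<suc ((i + 1#) * b))) A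
    v , v<m , g ← h
    let w≤ = <+1⇒≤ w≤s
        A≤ = ≤-trans (Pair-≤ˡ f) w≤
    return (v , return (z , ≤⇒<+1 (Pair-≤ˡ e) , return (w , w≤s
      , return (A , ≤⇒<+1 A≤ , return (b , ≤⇒<+1 (≤-trans (Pair-≤ʳ f) w≤)
      , return (q , ≤⇒<+1 (≤-trans (≤-trans (≤-trans (≤-multiple b i) x≤x+y) (≤-reflexive (sym g))) A≤)
      , e , f , v<m , g))))))

  -- This is why bounds involve r + 1: from r μ ≤ v only r ≤ N would follow.
  <-quotient : ∀ {r N μ v} → (r + 1#) * μ ≤ v → v <ᴹ (N + 1#) * μ → r <ᴹ N
  <-quotient {r} {N} {μ} p q = <-stable do
    inj₁ N≤r ← ≤-or-> N r
      where inj₂ h → return h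
    d , e ← N≤r
    λ _ → irrefl refl (<-≤-trans (≤-<-trans p q) (wit (d * μ)
      (trans (solve 3 (λ n d m → (n :+ con 1) :* m :+ d :* m := (n :+ d :+ con 1) :* m) refl N d μ)
             (*-congʳ (+-congʳ e)))))

  module _ (m n₀ : D) where

    private
      μ : D
      μ = m + 1#
      params : Env
      params = m ◂ n₀ ◂ origin

    least-unique : ∀ x y y' → LeastBound m n₀ x y → LeastBound m n₀ x y' → y ≈ y'
    least-unique x y y' (p , below) (p' , below') = ≈-stable (trichotomy y y' >>= λ
      { (inj₁ y<y')        → λ _ → below' y y<y' p
      ; (inj₂ (inj₁ e))    → return e
      ; (inj₂ (inj₂ y'<y)) → λ _ → below y' y'<y p' })

    least-exists : ∀ {x y} → Bound m n₀ x y → K (Σ D (LeastBound m n₀ x))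
    -- The least number principle: `none`, the continuation, assumes that there is no least bound,
    -- and induction then excludes every bound.
    least-exists {x} {y} p none = none-below (y + 1#) y <+1 p
      where
      none-below : ∀ z → NoBoundBelow m n₀ x z
      none-below = induction (Traceᶠ.NoBoundBelow (free 2) (free 3) (free 1) (free 0) 0) (x ◂ params)
        (λ _ q _ → ≮0 q)
        λ z below → all<-suc (Traceᶠ.Bound (free 2) (free 3) (free 1) (free 0) 0 imp fls) (x ◂ params)
                below λ q → none (z , q , below)

    bound-intro : ∀ {A b l α n r} → α <ᴹ μ → Comp A b l → Row A b l α n → Next A b l α n r →
      K (Σ D (Bound m n₀ (n * μ + α)))
    bound-intro {A} {b} {l} {α} {n} {r} α<μ c row nx = return (Y
      , return (A , ≤⇒<+1 (≤-trans x≤x+y (≤-trans x≤x+y (≤-trans x≤x+y x≤x+y)))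
      , return (b , ≤⇒<+1 (≤-trans y≤x+y (≤-trans x≤x+y (≤-trans x≤x+y x≤x+y)))
      , return (l , ≤⇒<+1 (≤-trans y≤x+y (≤-trans x≤x+y x≤x+y))
      , return (α , α<μ
      , return (n , ≤⇒<+1 (≤-trans ≤*suc x≤x+y)
      , return (r , ≤⇒<+1 (≤-trans (≤-trans x≤x+y ≤*suc) rY)
      , refl , c , row , nx , ≤⇒<+1 rY , ≤⇒<+1 y≤x+y)))))))
      where
      Y = A + b + l + (r + 1#) * μ + (n₀ + 1#) * μ
      rY : (r + 1#) * μ ≤ Y
      rY = ≤-trans y≤x+y x≤x+y

    bound-elim : ∀ {α n y} → α <ᴹ μ → Bound m n₀ (n * μ + α) y →
      K (Σ D λ A → Σ D λ b → Σ D λ l → Σ D λ r → Comp A b l × Row A b l α n × Next A b l α n r ×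
              (r + 1#) * μ ≤ y)
    bound-elim {α} {n} α<μ h = do
      A , _ , h ← h
      b , _ , h ← h
      l , _ , h ← h
      α' , α'<μ , h ← h
      n' , _ , h ← h
      r , _ , e , c , row , nx , r≤y , _ ← h
      n'≈n , α'≈α ← div-unique α'<μ α<μ (sym e)
      let row' , nx' = replace (Traceᶠ.Row (free 1) (free 2) (free 3) (free 0) (free 5) 0
              & Traceᶠ.Next (free 1) (free 2) (free 3) (free 0) (free 5) (free 4) 0)
                         (A ◂ b ◂ l ◂ r ◂ n ◂ origin) α'≈α
                       (replace (Traceᶠ.Row (free 1) (free 2) (free 3) (free 5) (free 0) 0
                               & Traceᶠ.Next (free 1) (free 2) (free 3) (free 5) (free 0) (free 4) 0)
                         (A ◂ b ◂ l ◂ r ◂ α' ◂ origin) n'≈n (row , nx))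
      return (A , b , l , r , c , row' , nx' , <+1⇒≤ r≤y)

    bound-≥ : ∀ {x y} → Bound m n₀ x y → (n₀ + 1#) * μ ≤ y
    bound-≥ h = do
      A , _ , h ← h
      b , _ , h ← h
      l , _ , h ← h
      α' , α'<μ , h ← h
      n' , _ , h ← h
      r , _ , e , c , row , nx , _ , n₀≤y ← h
      <+1⇒≤ n₀≤y

    next : ∀ {A b l α n} → Row A b l α n → K (Σ D (Next A b l α n))
    next {n = n} row = do
      inj₂ (n' , e) ← 0-or-suc n
        where inj₁ e → return (1# , return (inj₁ (e , refl)))
      let n'<n = <-resp refl (sym e) <+1
      r , _ , h ← row n' n'<n
      return (r , return (inj₂ (return (n' , <-trans n'<n <+1 , e , h))))

    row-suc : ∀ {a u v N N'} → a + 1# <ᴹ μ →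
      (∀ {x y} → x ≤ u → LeastBound m n₀ x y → y ≤ v) →
      N * μ ≤ u → v <ᴹ (N' + 1#) * μ → HasRow a N' → HasRow (a + 1#) N
    row-suc {a} {u} {v} {N} {N'} a+1<μ approx Nμ≤u v<N'+1 prev =
      row-induction (a + 1#) N λ {_} {_} {_} {n} n<N c row → do
      r , nx ← next row
      y , bd ← bound-intro a+1<μ c row nx
      y , least ← least-exists bd
      d , e ← <-elim n<N
      -- From a+1 < μ and n < N: nμ + (a+1) < (n+1)μ ≤ Nμ ≤ u.
      let x≤u : n * μ + (a + 1#) ≤ u
          x≤u = ≤-trans (≤-trans (<⇒≤ (+-monoʳ-< (n * μ) a+1<μ)) (wit (d * μ)
                  (trans (solve 3 (λ n m d → n :* m :+ m :+ d :* m
                          := (n :+ (d :+ con 1)) :* m) refl n μ d) (*-congʳ e)))) Nμ≤u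
      -- The least bound brings its own computation, and the approximation controls the argument r
      -- of that one. It replaces the computation built so far, which served to show that a bound
      -- exists.
      A₁ , b₁ , l₁ , r , c₁ , row₁ , nx₁ , r≤y ← bound-elim a+1<μ (proj₁ least)
      A₂ , b₂ , l₂ , c₂ , row₂ ← prev
      k , _ , h ← row₂ r (<-quotient (≤-trans r≤y (approx x≤u least)) v<N'+1)
      A , b , l , c , f , _ , h' ← merge c₁ c₂ λ f g → justify (Next-map f nx₁) (Has-map g h)
      return (A , b , l , c , extend-row f row₁ h')

    module _ {s : D} (lth : Lth s (μ + 1#))
      (approx : ∀ i {u v x y} → i + 1# <ᴹ μ + 1# → Ent s i u → Ent s (i + 1#) v →
        x ≤ u → LeastBound m n₀ x y → y ≤ v) where

      stages : ∀ a → Stage s m a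
      stages = induction (Traceᶠ.Stage (free 1) (free 2) (free 0) 0) (s ◂ m ◂ origin)
        (do
          -- Level 0 sits at the last index m+1, where rows of any length are available outright.
          u , ent ← entries lth μ
          N , h ← quotient (0<suc m) u
          r , r<μ , e ← h
          A , b , l , c , row ← row-zero N
          return (μ , return (u , return (N , return (A , return (b , return (l , λ _ →
            +-identityʳ μ , ent , <+1μ r<μ e , c , row)))))))
        λ a h → do
          inj₁ a+1<μ ← lem (a + 1# <ᴹ μ)
            where inj₂ ¬h → return (0# , return
                    (0# , return (0# , return (0# , return (0# , return (0# , λ p →
                    ≈-stable (λ _ → ¬h p) , (λ _ → ¬h p) , <-stable (λ _ → ¬h p) , (λ _ _ _ → ¬h p)
                    , λ _ _ _ → ¬h p))))))
          i , h ← h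
          v , h ← h
          N' , h ← h
          A , h ← h
          b , h ← h
          l , h ← h
          let i+a≈μ , ent , v<N'+1 , c , row = h (<-trans <+1 a+1<μ)
          -- Index 0 would mean a ≈ μ, against a+1 < μ.
          inj₂ (i' , i≈i'+1) ← 0-or-suc i
            where inj₁ i≈0 → λ _ → irrefl
                    (trans (sym (+-identityˡ a)) (trans (+-congʳ (sym i≈0)) i+a≈μ)) (<-trans <+1 a+1<μ)
          u , ent' ← entries lth i'
          N , h ← quotient (0<suc m) u
          r , r<μ , e ← h
          let ent⁺ : Ent s (i' + 1#) v
              ent⁺ = replace (Encodingᶠ.Ent (free 1) (free 0) (free 2) 0) (s ◂ v ◂ origin) i≈i'+1 ent
              i'<  : i' + 1# <ᴹ μ + 1#
              i'<  = ≤⇒<+1 (≤-trans (≤-reflexive (sym i≈i'+1)) (≤-trans x≤x+y (≤-reflexive i+a≈μ)))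
          A' , b' , l' , c' , row' ← row-suc a+1<μ (approx i' i'< ent' ent⁺)
            (≤-trans x≤x+y (≤-reflexive (sym e))) v<N'+1 (return (A , b , l , c , row))
          return (i' , return (u , return (N , return (A' , return (b' , return (l' , λ _ →
            trans (solve 2 (λ i a → i :+ (a :+ con 1)
                    := i :+ con 1 :+ a) refl i' a) (trans (+-congʳ (sym i≈i'+1)) i+a≈μ)
            , ent' , <+1μ r<μ e , c' , row'))))))
        where
        <+1μ : ∀ {u N r} → r <ᴹ μ → u ≈ N * μ + r → u <ᴹ (N + 1#) * μ
        <+1μ {u} {N} r<μ e = <-resp (sym e) (solve 2 (λ n m → n :* m :+ m
                := (n :+ con 1) :* m) refl N μ) (+-monoʳ-< (N * μ) r<μ)

      value : K (Σ D λ A → Σ D λ b → Σ D λ l → Comp A b l × Filled A b l m n₀)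
      value = do
        i , h ← stages m
        u , h ← h
        N , h ← h
        A , h ← h
        b , h ← h
        l , h ← h
        let i+m≈μ , ent , u<N+1 , c , row = h <+1
            i≈0+1 : i ≈ 0# + 1#
            i≈0+1 = trans (+-cancelʳ m (trans i+m≈μ (+-comm m 1#))) (sym (+-identityˡ 1#))
        u₀ , ent₀ ← entries lth 0#
        -- The pair (0,0) with the empty computation, whose code 0 lies below the unknown entry
        -- (s)_0. It is there to make φ(0) defined, which puts (n₀+1)μ below (s)_1.
        y , bd ← bound-intro {0#} {0#} {0#} {0#} {0#} {1#} (0<suc m) (λ _ p _ → ≮0 p) (λ _ p _ → ≮0 p)
                (return (inj₁ (refl , refl)))
        y , least ← least-exists bd
        let y≤u = approx 0# (+-monoˡ-< 1# (0<suc m)) ent₀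
                    (replace (Encodingᶠ.Ent (free 1) (free 0) (free 2) 0) (s ◂ u ◂ origin) i≈0+1 ent)
                    (≤-trans (≤-reflexive (trans (+-identityʳ (0# * μ)) (zeroˡ μ))) 0≤) least
        return (A , b , l , c , row n₀ (<-quotient (≤-trans (bound-≥ (proj₁ least)) y≤u) u<N+1))

    computed : K (Σ D λ A → Σ D λ b → Σ D λ l → Comp A b l × Filled A b l m n₀)
    computed = do
      s , lth , approx ← monotone-approximation
              (Traceᶠ.LeastBound (free 2) (free 3) (free 1) (free 0) 0) params least-unique (μ + 1#)
      value {s} lth approx

  -- From computations to the codes in the defining formula of A

  module _ {A b l w s : D} (pw : Pair A b w) (ps : Pair l w s) where

    w≤s : w ≤ s
    w≤s = Pair-≤ʳ ps

    A≤s : A ≤ s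
    A≤s = ≤-trans (Pair-≤ˡ pw) w≤s

    Rem⇒Ent : ∀ {j v} → Rem A b j v → Ent s j v
    Rem⇒Ent (v<m , h) = do
      q , q≤A , e ← h
      return (l , ≤⇒<+1 (Pair-≤ˡ ps) , return (w , ≤⇒<+1 w≤s , return (A , ≤⇒<+1 A≤s
        , return (b , ≤⇒<+1 (≤-trans (Pair-≤ʳ pw) w≤s) , return (q , ≤⇒<+1 (≤-trans (<+1⇒≤ q≤A) A≤s)
        , ps , pw , v<m , e)))))

    Entry⇒Ent : ∀ {j α n k} → Entry A b j α n k → K (Σ D λ t → t <ᴹ s + 1# × Ent s j t × Trip α n k t)
    Entry⇒Ent h = do
      t , t≤A , r , e ← h
      return (t , ≤⇒<+1 (≤-trans (<+1⇒≤ t≤A) A≤s) , Rem⇒Ent r , e)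

    Good⇒GoodCode : ∀ {j} → Good A b j → GoodCode s j
    Good⇒GoodCode {j} h = do
      α , _ , h ← h
      n , _ , h ← h
      k , _ , h , J ← h
      t , t≤s , e , tr ← Entry⇒Ent h
      α≤A , n≤A , k≤A ← Entry-≤ h
      return (t , t≤s , return (α , ≤⇒<+1 (≤-trans α≤A A≤s) , return (n , ≤⇒<+1 (≤-trans n≤A A≤s)
        , return (k , ≤⇒<+1 (≤-trans k≤A A≤s) , e , tr , (J >>= λ
        { (inj₁ e) → return (inj₁ e)
        ; (inj₂ h) → do
            α' , _ , α≈α'+1 , h ← h
            r , _ , nx , h ← h
            j₂ , j₂<j , h ← h
            α'≤A , r≤A , _ ← Entry-≤ h
            t₂ , t₂≤s , e₂ , tr₂ ← Entry⇒Ent h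
            let 0<α = <-resp refl (sym α≈α'+1) (0<suc α')
                α'≤s = ≤⇒<+1 (≤-trans α'≤A A≤s)
            -- The two ways of obtaining r become the second and the third clause of `GoodCode`.
            nx >>= λ
              { (inj₁ (n≈0 , r≈1)) → return (inj₂ (return (inj₁ (0<α , n≈0 , return (j₂ , j₂<j
                  , return (t₂ , t₂≤s , return (α' , α'≤s , e₂ , sym α≈α'+1
                  , replace (Encodingᶠ.Trip (free 1) (free 0) (free 2) (free 3) 0)
                          (α' ◂ k ◂ t₂ ◂ origin) r≈1 tr₂)))))))
              ; (inj₂ h) → do
                  n' , _ , n≈n'+1 , h ← h
                  j₁ , j₁<j , h ← h
                  _ , n'≤A , _ ← Entry-≤ h
                  t₁ , t₁≤s , e₁ , tr₁ ← Entry⇒Ent h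
                  return (inj₂ (return (inj₂ (0<α , <-resp refl (sym n≈n'+1) (0<suc n')
                    , return (j₁ , j₁<j , return (j₂ , j₂<j , return (t₁ , t₁≤s , return (t₂ , t₂≤s
                    , return (α' , α'≤s , return
                            (n' , ≤⇒<+1 (≤-trans n'≤A A≤s) , return (r , ≤⇒<+1 (≤-trans r≤A A≤s)
                    , e₁ , e₂ , sym α≈α'+1 , sym n≈n'+1 , tr₁ , tr₂)))))))))))
              }
        })))))

  total : Total
  total m n = do
    A , b , l , c , h ← computed m n
    k , _ , h ← h
    w , pw ← pair A b
    s , ps ← pair l w
    j , j<l , h ← h
    t , t≤s , e , tr ← Entry⇒Ent pw ps h
    return (k , return (s , return (l
      , return (w , ≤⇒<+1 (Pair-≤ʳ ps) , ps)
      , (λ j j<l → Good⇒GoodCode pw ps (c j j<l))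
      , return (j , j<l , return (t , t≤s , e , tr)))))

theorem3p1 : PΣ₁ ⊢ AckTotal
theorem3p1 = Completeness.complete PΣ₁ λ M isM ρ →
  let open Totality M isM in to (Encodingᶠ.Total 0) ρ total
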